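{- Let $d \ge 3$ be a prime, and define polynomials $r_n, s_n \in \mathbb{Z}[b]$ by $r_0 = s_0 = 1$ and, for $n \ge 0$, \[ r_{n+1} = (b+1)\,d\, r_n s_n^{d-1}, \qquad s_{n+1} = r_n^d + (d-1) s_n^d. \] For $m \ge 1$ set $\sigma_m = (b+1)d\, s_{m-1}^d$, $\tau_m = s_m - \sigma_m$, and \[ \mathcal{G}_m = \frac{1}{bd}\left[(b+1)^d d^d s_{m-1}^{d(d-1)} - (bd+1)\,\frac{s_m^d - \bigl((b+1)d\, s_{m-1}^d\bigr)^d}{s_m - (b+1)d\, s_{m-1}^d}\right] \in \mathbb{Z}[b]. \] Let $D_k = \frac{d^k - 1}{d - 1}$. Then for every $m \ge 1$: (i) $N_d^-(\mathcal{G}_m) = L\bigl((0, d^m - 1), (d^m - d^{m-1} - 1, d^m - d^{m-1} - 1)\bigr)$; (ii) $N_d^-(\tau_m) = L\bigl((d^i + (m-1-i),\, d^i D_{m-i}) : i = 0, \dots, m-1\bigr) = L\bigl((m, D_m), (d + (m-2), d D_{m-1}), \dots, (d^{m-1}, d^{m-1})\bigr)$.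
   Context: For a prime $p$ and $f(z) = \sum_{i=0}^n a_i z^i \in \mathbb{Q}[z]$ with $a_n \ne 0$, write $v_i(f) = \mathrm{ord}_p(a_i)$ (with $\mathrm{ord}_p(0) = \infty$). The $p$-Newton polygon $N_p(f)$ is the lower convex hull of the points $(i, v_i(f))$, $0 \le i \le n$; its vertices are the points where the slope changes, together with the two endpoints. The principal $p$-Newton polygon $N_p^-(f)$ is the part of $N_p(f)$ consisting of the segments of negative slope (including slope $-\infty$). The notation $N_p^-(f) = L\bigl((i_1, v_{i_1}(f)), \dots, (i_k, v_{i_k}(f))\bigr)$ means that $i_1 = \min\{i : v_i(f) < \infty\}$ (the initial point is $(i_1, v_{i_1}(f))$), $i_1 < \cdots < i_k$, and these are exactly the vertices of $N_p^-(f)$ with finite coordinates. Here the polynomials are in the variable $b$ and $p = d$. -}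

module Defs where

open import Data.Nat as ℕ using (ℕ; zero; suc; _∸_; _^_)
open import Data.Nat.Divisibility using (_∣_)
open import Data.Integer as ℤ using (ℤ; +_; 0ℤ; 1ℤ; ∣_∣)
open import Data.List using (List; []; _∷_; map)
open import Data.List.Relation.Unary.All using (All)
open import Data.Product using (_×_; _,_; proj₁; proj₂)
open import Relation.Binary.PropositionalEquality using (_≡_)
open import Relation.Nullary using (¬_)
open import Data.Empty using (⊥)

-- Polynomials in ℤ[b] as coefficient lists (constant term first).
-- Trailing zeros are allowed; equality is coefficientwise (_≈ᴾ_).

Poly : Set
Poly = List ℤ

coeff : Poly → ℕ → ℤ
coeff []      _       = 0ℤ
coeff (a ∷ p) zero    = a
coeff (a ∷ p) (suc i) = coeff p i

infix 4 _≈ᴾ_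

_≈ᴾ_ : Poly → Poly → Set
p ≈ᴾ q = ∀ i → coeff p i ≡ coeff q i

infixl 6 _⊕_ _⊖_
infixl 7 _⊗_

_⊕_ : Poly → Poly → Poly
[]      ⊕ q       = q
(a ∷ p) ⊕ []      = a ∷ p
(a ∷ p) ⊕ (c ∷ q) = (a ℤ.+ c) ∷ (p ⊕ q)

scale : ℤ → Poly → Poly
scale c p = map (c ℤ.*_) p

negᴾ : Poly → Poly
negᴾ p = map ℤ.-_ p

_⊖_ : Poly → Poly → Poly
p ⊖ q = p ⊕ negᴾ q

_⊗_ : Poly → Poly → Poly
[]      ⊗ q = []
(a ∷ p) ⊗ q = scale a q ⊕ (0ℤ ∷ (p ⊗ q))

const : ℤ → Poly
const c = c ∷ []

oneᴾ : Poly
oneᴾ = const 1ℤ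

X : Poly
X = 0ℤ ∷ 1ℤ ∷ []

powᴾ : Poly → ℕ → Poly
powᴾ p zero    = oneᴾ
powᴾ p (suc n) = p ⊗ powᴾ p n

b+1 : Poly
b+1 = X ⊕ oneᴾ

rs : ℕ → ℕ → Poly × Poly
rs d zero    = oneᴾ , oneᴾ
rs d (suc n) =
  (b+1 ⊗ const (+ d) ⊗ proj₁ (rs d n) ⊗ powᴾ (proj₂ (rs d n)) (d ∸ 1)) ,
  (powᴾ (proj₁ (rs d n)) d ⊕ const (+ (d ∸ 1)) ⊗ powᴾ (proj₂ (rs d n)) d)

r s : ℕ → ℕ → Poly
r d n = proj₁ (rs d n)
s d n = proj₂ (rs d n)

σ τ : ℕ → ℕ → Poly
σ d m = b+1 ⊗ const (+ d) ⊗ powᴾ (s d (m ∸ 1)) d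
τ d m = s d m ⊖ σ d m

bd bd+1 : ℕ → Poly
bd d = const (+ d) ⊗ X
bd+1 d = bd d ⊕ oneᴾ

-- Defining equation of 𝒢_m, multiplied out:
--   b d · G · (s_m - σ_m)
--     = (b+1)^d d^d s_{m-1}^{d(d-1)} · (s_m - σ_m) - (bd+1) (s_m^d - σ_m^d)
IsGm : ℕ → ℕ → Poly → Set
IsGm d m G =
  bd d ⊗ G ⊗ (s d m ⊖ σ d m)
    ≈ᴾ (powᴾ b+1 d ⊗ const (+ (d ^ d)) ⊗ powᴾ (s d (m ∸ 1)) (d ℕ.* (d ∸ 1))
          ⊗ (s d m ⊖ σ d m)
        ⊖ bd+1 d ⊗ (powᴾ (s d m) d ⊖ powᴾ (σ d m) d))

-- D_k = (d^k - 1)/(d - 1) = 1 + d + ... + d^(k-1)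
D : ℕ → ℕ → ℕ
D d zero    = 0
D d (suc k) = 1 ℕ.+ d ℕ.* D d k

-- p-adic valuation of an integer coefficient: HasVal p a v means
-- a ≠ 0 and ord_p(a) = v.  (Coefficients a = 0, i.e. ord = ∞, have no v.)

HasVal : ℕ → ℤ → ℕ → Set
HasVal p a v = ¬ (a ≡ 0ℤ) × (p ^ v ∣ ∣ a ∣) × ¬ (p ^ suc v ∣ ∣ a ∣)

Pt : Set
Pt = ℕ × ℕ

pairs : List Pt → List (Pt × Pt)
pairs (a ∷ c ∷ t) = (a , c) ∷ pairs (c ∷ t)
pairs _           = []

triples : List Pt → List (Pt × Pt × Pt)
triples (a ∷ c ∷ e ∷ t) = (a , c , e) ∷ triples (c ∷ e ∷ t)
triples _               = []

lastPt : Pt → List Pt → Pt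
lastPt a []      = a
lastPt a (c ∷ t) = lastPt c t

-- the edge from P=(x,y) to P'=(x',y') is a genuine edge of the lower hull
-- of negative slope: x < x', y' < y, and every point (i, v_i(f)) lies on
-- or above the line through P and P'.
LowerEdge : ℕ → Poly → Pt × Pt → Set
LowerEdge p f ((x , y) , (x' , y')) =
  (x ℕ.< x') × (y' ℕ.< y) ×
  (∀ i v → HasVal p (coeff f i) v →
     ((+ y' ℤ.- + y) ℤ.* (+ i ℤ.- + x)) ℤ.≤ ((+ v ℤ.- + y) ℤ.* (+ x' ℤ.- + x)))

-- consecutive edges have strictly increasing slopes (so every listed
-- point is a vertex)
SlopeIncr : Pt × Pt × Pt → Set
SlopeIncr ((x₁ , y₁) , (x₂ , y₂) , (x₃ , y₃)) =
  ((+ y₂ ℤ.- + y₁) ℤ.* (+ x₃ ℤ.- + x₂)) ℤ.< ((+ y₃ ℤ.- + y₂) ℤ.* (+ x₂ ℤ.- + x₁))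

PrincipalNP : ℕ → Poly → List Pt → Set
PrincipalNP p f []                  = ⊥
PrincipalNP p f ((x₁ , y₁) ∷ rest) =
  All (λ P → HasVal p (coeff f (proj₁ P)) (proj₂ P)) ((x₁ , y₁) ∷ rest) ×
  (∀ i → i ℕ.< x₁ → coeff f i ≡ 0ℤ) ×
  All (LowerEdge p f) (pairs ((x₁ , y₁) ∷ rest)) ×
  All SlopeIncr (triples ((x₁ , y₁) ∷ rest)) ×
  -- after the last vertex the hull has slope ≥ 0: no point lies below it
  (∀ i v → HasVal p (coeff f i) v → proj₂ (lastPt (x₁ , y₁) rest) ℕ.≤ v)

{-# OPTIONS --safe #-}

-- Write M = d^(m-1), σ = σ_m, τ = τ_m. Since σ^(d-1) (b+1) d = (b+1)^d d^d s_{m-1}^(d(d-1)),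
-- expanding s_m^d = (σ + τ)^d gives τ_{m+1} = b d 𝒢_m τ_m, hence τ_m = b d θ_m with
-- θ_1 = -1, θ_{m+1} = b d 𝒢_m θ_m, and
--   𝒢_m = -(d-1) σ^(d-1) - (bd+1) θ_m Σ_{j ≥ 2} C(d,j) τ^(j-2) σ^(d-j).
-- Filter ℤ[b] by giving b weight 1 and d weight d-1. Because d divides the inner binomial
-- coefficients, an induction shows that σ has weight at least dM - 1, that τ_m ≡ ±(db)^M and
-- that 𝒢_m ≡ ±(db)^((d-1)M-1), both modulo higher weight. Together with divisibility of 𝒢_m
-- by d^((d-1)M-1) and the value of 𝒢_m(0) this determines the polygon of 𝒢_m. The polygon of
-- τ_m = -(bd)^m 𝒢_1 ⋯ 𝒢_{m-1} is then the concatenation of those of the factors; each vertex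
-- and each edge is isolated by a weight of its own, for which leading terms are multiplicative.

module Submission where

open import Defs
open import Algebra using (CommutativeRing)
open import Data.Empty using (⊥-elim)
open import Data.Integer as ℤ using (ℤ; +_; 0ℤ; 1ℤ; ∣_∣)
open import Data.Integer.Divisibility.Signed using (_∣_; divides; ∣-trans; ∣ᵤ⇒∣; ∣⇒∣ᵤ;
  ∣m∣n⇒∣m+n; ∣m+n∣n⇒∣m; ∣m⇒∣-m; ∣n⇒∣m*n; *-monoˡ-∣; *-cancelʳ-∣)
import Data.Integer.Properties as ℤ
import Data.Integer.Tactic.RingSolver as ℤ-Solver
open import Data.List using (List; []; _∷_; map; upTo; applyUpTo)
open import Data.List.Properties using (map-upTo)
open import Data.List.Relation.Unary.All using (All; []; _∷_)
open import Data.List.Relation.Unary.All.Properties using (applyUpTo⁺₁)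
open import Data.Maybe as Maybe using (Maybe; just; nothing)
open import Data.Nat as ℕ using (ℕ; zero; suc; _≤_; _<_; _∸_; _^_; _+_; _*_; z≤n; s≤s; NonZero)
open import Data.Nat.Combinatorics using (_C_; nCk+nC[k+1]≡[n+1]C[k+1]; k>n⇒nCk≡0; nCn≡1; nC1≡n)
import Data.Nat.Divisibility as ℕ∣
open import Data.Nat.Primality using (Prime; euclidsLemma; prime⇒nonZero; prime⇒nonTrivial)
import Data.Nat.Properties as ℕ
import Data.Nat.Tactic.RingSolver as ℕ-Solver
open import Data.Product using (Σ-syntax; _×_; _,_; proj₁; proj₂)
open import Data.Sum using (inj₁; inj₂; [_,_]′)
open import Function using (_∘_)
open import Level using (0ℓ)
open import Relation.Binary using (IsEquivalence)
open import Relation.Binary.PropositionalEquality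
import Relation.Binary.Reasoning.Setoid as SetoidReasoning
open import Relation.Nullary using (¬_; yes; no)
open import Tactic.RingSolver using (solve-∀)
open import Tactic.RingSolver.Core.AlmostCommutativeRing using (AlmostCommutativeRing; fromCommutativeRing)

-- The margins are exactly 1. In the weights d - 1 for d and 1 for b, the ends of the polygon of 𝒢_m
-- have weight d((d-1)M - 1) + 1 on the left and d((d-1)M - 1) on the right. Knowing the leading
-- monomial modulo the next weight therefore puts every other point on or above the line of slope
-- -1/(d-1) through the left end. The edge starts at the same point with the steeper slope
-- -M/((d-1)M - 1), so it runs below that line. The left end itself is invisible to the leading
-- monomial and is computed at b = 0. For m ≥ 2 the factor b of θ_m leaves -(d-1) d^(dM-1). For m =
-- 1 the quadratic binomial term also survives and the value is -((d-1)/2) d^(d-1); here d must be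
-- odd. The slopes of the 𝒢_m are distinct and tend to -1/(d-1), so no single weight shows all
-- vertices of τ_m. This is why filtrations and leading terms are developed for arbitrary weights,
-- and why the bounds on 𝒢_m are carried from one weight to another through its coefficients.

-- _≈ᴾ_ wrapped in a record, so that unification recovers both polynomials.
infix 4 _≋_
record _≋_ (p q : Poly) : Set where
  constructor mk
  field coeffs : p ≈ᴾ q
open _≋_

-- The commutative ring of coefficient lists.

coeff-⊕ : ∀ p q i → coeff (p ⊕ q) i ≡ coeff p i ℤ.+ coeff q i
coeff-⊕ []      q       i       = sym (ℤ.+-identityˡ _)
coeff-⊕ (a ∷ p) []      i       = sym (ℤ.+-identityʳ _)
coeff-⊕ (a ∷ p) (c ∷ q) zero    = refl
coeff-⊕ (a ∷ p) (c ∷ q) (suc i) = coeff-⊕ p q i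

coeff-scale : ∀ c p i → coeff (scale c p) i ≡ c ℤ.* coeff p i
coeff-scale c []      i       = sym (ℤ.*-zeroʳ c)
coeff-scale c (a ∷ p) zero    = refl
coeff-scale c (a ∷ p) (suc i) = coeff-scale c p i

coeff-neg : ∀ p i → coeff (negᴾ p) i ≡ ℤ.- coeff p i
coeff-neg []      i       = refl
coeff-neg (a ∷ p) zero    = refl
coeff-neg (a ∷ p) (suc i) = coeff-neg p i

≋-isEquivalence : IsEquivalence _≋_
≋-isEquivalence = record
  { refl  = mk λ _ → refl
  ; sym   = λ (mk e) → mk λ i → sym (e i)
  ; trans = λ (mk e) (mk f) → mk λ i → trans (e i) (f i)
  }

open IsEquivalence ≋-isEquivalence
  renaming (refl to ≋-refl; sym to ≋-sym; trans to ≋-trans; reflexive to ≋-reflexive)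

⊕-cong : ∀ {p p′ q q′} → p ≋ p′ → q ≋ q′ → p ⊕ q ≋ p′ ⊕ q′
⊕-cong {p} {p′} {q} {q′} (mk e) (mk f) = mk λ i →
  trans (coeff-⊕ p q i) (trans (cong₂ ℤ._+_ (e i) (f i)) (sym (coeff-⊕ p′ q′ i)))

scale-cong : ∀ c {p q} → p ≋ q → scale c p ≋ scale c q
scale-cong c {p} {q} (mk e) = mk λ i →
  trans (coeff-scale c p i) (trans (cong (c ℤ.*_) (e i)) (sym (coeff-scale c q i)))

negᴾ-cong : ∀ {p q} → p ≋ q → negᴾ p ≋ negᴾ q
negᴾ-cong {p} {q} (mk e) = mk λ i →
  trans (coeff-neg p i) (trans (cong ℤ.-_ (e i)) (sym (coeff-neg q i)))

∷-cong : ∀ {a c p q} → a ≡ c → p ≋ q → a ∷ p ≋ c ∷ q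
∷-cong a≡c (mk e) = mk λ { zero → a≡c ; (suc i) → e i }

⊕-congˡ : ∀ q {p p′} → p ≋ p′ → p ⊕ q ≋ p′ ⊕ q
⊕-congˡ q e = ⊕-cong e (≋-refl {q})

⊕-congʳ : ∀ p {q q′} → q ≋ q′ → p ⊕ q ≋ p ⊕ q′
⊕-congʳ p e = ⊕-cong (≋-refl {p}) e

⊖-congʳ : ∀ p {q q′} → q ≋ q′ → p ⊖ q ≋ p ⊖ q′
⊖-congʳ p e = ⊕-cong (≋-refl {p}) (negᴾ-cong e)

const-cong : ∀ {a c} → a ≡ c → const a ≋ const c
const-cong refl = ≋-refl

⊕-assoc : ∀ p q u → (p ⊕ q) ⊕ u ≋ p ⊕ (q ⊕ u)
⊕-assoc p q u = mk λ i → begin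
  coeff ((p ⊕ q) ⊕ u) i                     ≡⟨ coeff-⊕ (p ⊕ q) u i ⟩
  coeff (p ⊕ q) i ℤ.+ coeff u i             ≡⟨ cong (ℤ._+ coeff u i) (coeff-⊕ p q i) ⟩
  coeff p i ℤ.+ coeff q i ℤ.+ coeff u i     ≡⟨ ℤ.+-assoc (coeff p i) (coeff q i) (coeff u i) ⟩
  coeff p i ℤ.+ (coeff q i ℤ.+ coeff u i)   ≡⟨ cong (λ z → coeff p i ℤ.+ z) (coeff-⊕ q u i) ⟨
  coeff p i ℤ.+ coeff (q ⊕ u) i             ≡⟨ coeff-⊕ p (q ⊕ u) i ⟨
  coeff (p ⊕ (q ⊕ u)) i                     ∎
  where open ≡-Reasoning

⊕-comm : ∀ p q → p ⊕ q ≋ q ⊕ p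
⊕-comm p q = mk λ i → trans (coeff-⊕ p q i)
  (trans (ℤ.+-comm (coeff p i) (coeff q i)) (sym (coeff-⊕ q p i)))

⊕-identityʳ : ∀ p → p ⊕ [] ≋ p
⊕-identityʳ p = mk λ i → trans (coeff-⊕ p [] i) (ℤ.+-identityʳ _)

⊕-inverseʳ : ∀ p → p ⊖ p ≋ []
⊕-inverseʳ p = mk λ i → trans (coeff-⊕ p (negᴾ p) i)
  (trans (cong (λ z → coeff p i ℤ.+ z) (coeff-neg p i)) (ℤ.+-inverseʳ (coeff p i)))

⊕-interchange : ∀ p q u v → (p ⊕ q) ⊕ (u ⊕ v) ≋ (p ⊕ u) ⊕ (q ⊕ v)
⊕-interchange p q u v = mk λ i → begin
  coeff ((p ⊕ q) ⊕ (u ⊕ v)) i  ≡⟨ expand p q u v i ⟩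
  _                            ≡⟨ swap (coeff p i) (coeff q i) (coeff u i) (coeff v i) ⟩
  _                            ≡⟨ expand p u q v i ⟨
  coeff ((p ⊕ u) ⊕ (q ⊕ v)) i  ∎
  where
  open ≡-Reasoning
  expand : ∀ p q u v i → coeff ((p ⊕ q) ⊕ (u ⊕ v)) i ≡ (coeff p i ℤ.+ coeff q i) ℤ.+ (coeff u i ℤ.+ coeff v i)
  expand p q u v i = trans (coeff-⊕ (p ⊕ q) (u ⊕ v) i) (cong₂ ℤ._+_ (coeff-⊕ p q i) (coeff-⊕ u v i))
  swap : ∀ a b c e → (a ℤ.+ b) ℤ.+ (c ℤ.+ e) ≡ (a ℤ.+ c) ℤ.+ (b ℤ.+ e)
  swap = ℤ-Solver.solve-∀

scale-⊕ : ∀ c p q → scale c (p ⊕ q) ≋ scale c p ⊕ scale c q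
scale-⊕ c []      q       = ≋-refl
scale-⊕ c (a ∷ p) []      = ≋-refl
scale-⊕ c (a ∷ p) (e ∷ q) = ∷-cong (ℤ.*-distribˡ-+ c a e) (scale-⊕ c p q)

+-scale : ∀ a c p → scale (a ℤ.+ c) p ≋ scale a p ⊕ scale c p
+-scale a c []      = ≋-refl
+-scale a c (e ∷ p) = ∷-cong (ℤ.*-distribʳ-+ e a c) (+-scale a c p)

scale-scale : ∀ a c p → scale (a ℤ.* c) p ≋ scale a (scale c p)
scale-scale a c []      = ≋-refl
scale-scale a c (e ∷ p) = ∷-cong (ℤ.*-assoc a c e) (scale-scale a c p)

scale-zero : ∀ p → scale 0ℤ p ≋ []
scale-zero p = mk λ i → trans (coeff-scale 0ℤ p i) refl

scale-one : ∀ p → scale 1ℤ p ≋ p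
scale-one p = mk λ i → trans (coeff-scale 1ℤ p i) (ℤ.*-identityˡ _)

0∷[] : 0ℤ ∷ [] ≋ []
0∷[] = mk λ { zero → refl ; (suc i) → refl }

0∷-⊗ : ∀ p q → (0ℤ ∷ p) ⊗ q ≋ 0ℤ ∷ (p ⊗ q)
0∷-⊗ p q = ⊕-cong (scale-zero q) ≋-refl

const-⊗ : ∀ c p → const c ⊗ p ≋ scale c p
const-⊗ c p = ≋-trans (⊕-cong ≋-refl 0∷[]) (⊕-identityʳ _)

⊗-congʳ : ∀ p {q q′} → q ≋ q′ → p ⊗ q ≋ p ⊗ q′
⊗-congʳ []      e = ≋-refl
⊗-congʳ (a ∷ p) e = ⊕-cong (scale-cong a e) (∷-cong refl (⊗-congʳ p e))

⊗-zeroʳ : ∀ p → p ⊗ [] ≋ []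
⊗-zeroʳ []      = ≋-refl
⊗-zeroʳ (a ∷ p) = ≋-trans (∷-cong refl (⊗-zeroʳ p)) 0∷[]

⊗-∷ʳ : ∀ p c q → p ⊗ (c ∷ q) ≋ scale c p ⊕ (0ℤ ∷ (p ⊗ q))
⊗-∷ʳ []      c q = ≋-sym 0∷[]
⊗-∷ʳ (a ∷ p) c q = ∷-cong (cong (ℤ._+ 0ℤ) (ℤ.*-comm a c))
  (≋-trans (⊕-cong (≋-refl {scale a q}) (⊗-∷ʳ p c q))
  (≋-trans (≋-sym (⊕-assoc (scale a q) (scale c p) (0ℤ ∷ (p ⊗ q))))
  (≋-trans (⊕-cong (⊕-comm (scale a q) (scale c p)) ≋-refl)
           (⊕-assoc (scale c p) (scale a q) (0ℤ ∷ (p ⊗ q))))))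

⊗-comm : ∀ p q → p ⊗ q ≋ q ⊗ p
⊗-comm []      q = ≋-sym (⊗-zeroʳ q)
⊗-comm (a ∷ p) q = ≋-trans (⊕-cong ≋-refl (∷-cong refl (⊗-comm p q))) (≋-sym (⊗-∷ʳ q a p))

⊗-cong : ∀ {p p′ q q′} → p ≋ p′ → q ≋ q′ → p ⊗ q ≋ p′ ⊗ q′
⊗-cong {p} {p′} {q} {q′} e f = ≋-trans (⊗-congʳ p f)
  (≋-trans (⊗-comm p q′) (≋-trans (⊗-congʳ q′ e) (⊗-comm q′ p′)))

⊗-congˡ : ∀ q {p p′} → p ≋ p′ → p ⊗ q ≋ p′ ⊗ q
⊗-congˡ q e = ⊗-cong e (≋-refl {q})

⊗-distribʳ : ∀ u p q → (p ⊕ q) ⊗ u ≋ p ⊗ u ⊕ q ⊗ u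
⊗-distribʳ u []      q       = ≋-refl
⊗-distribʳ u (a ∷ p) []      = ≋-sym (⊕-identityʳ _)
⊗-distribʳ u (a ∷ p) (c ∷ q) =
  ≋-trans (⊕-cong (+-scale a c u) (∷-cong refl (⊗-distribʳ u p q)))
          (⊕-interchange (scale a u) (scale c u) (0ℤ ∷ (p ⊗ u)) (0ℤ ∷ (q ⊗ u)))

⊗-distribˡ : ∀ u p q → u ⊗ (p ⊕ q) ≋ u ⊗ p ⊕ u ⊗ q
⊗-distribˡ u p q = ≋-trans (⊗-comm u (p ⊕ q))
  (≋-trans (⊗-distribʳ u p q) (⊕-cong (⊗-comm p u) (⊗-comm q u)))

scale-⊗ : ∀ c p q → scale c p ⊗ q ≋ scale c (p ⊗ q)
scale-⊗ c []      q = ≋-refl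
scale-⊗ c (a ∷ p) q =
  ≋-trans (⊕-cong (scale-scale c a q) (∷-cong (sym (ℤ.*-zeroʳ c)) (scale-⊗ c p q)))
          (≋-sym (scale-⊕ c (scale a q) (0ℤ ∷ (p ⊗ q))))

⊗-assoc : ∀ p q u → (p ⊗ q) ⊗ u ≋ p ⊗ (q ⊗ u)
⊗-assoc []      q u = ≋-refl
⊗-assoc (a ∷ p) q u = ≋-trans (⊗-distribʳ u (scale a q) (0ℤ ∷ (p ⊗ q)))
  (⊕-cong (scale-⊗ a q u) (≋-trans (0∷-⊗ (p ⊗ q) u) (∷-cong refl (⊗-assoc p q u))))

⊗-identityˡ : ∀ p → oneᴾ ⊗ p ≋ p
⊗-identityˡ p = ≋-trans (const-⊗ 1ℤ p) (scale-one p)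

polyRing : CommutativeRing 0ℓ 0ℓ
polyRing = record
  { Carrier = Poly ; _≈_ = _≋_ ; _+_ = _⊕_ ; _*_ = _⊗_ ; -_ = negᴾ ; 0# = [] ; 1# = oneᴾ
  ; isCommutativeRing = record
    { isRing = record
      { +-isAbelianGroup = record
        { isGroup = record
          { isMonoid = record
            { isSemigroup = record
              { isMagma = record { isEquivalence = ≋-isEquivalence ; ∙-cong = ⊕-cong }
              ; assoc = ⊕-assoc }
            ; identity = (λ _ → ≋-refl) , ⊕-identityʳ }
          ; inverse = (λ p → ≋-trans (⊕-comm (negᴾ p) p) (⊕-inverseʳ p)) , ⊕-inverseʳ
          ; ⁻¹-cong = negᴾ-cong }
        ; comm = ⊕-comm }
      ; *-cong = ⊗-cong
      ; *-assoc = ⊗-assoc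
      ; *-identity = ⊗-identityˡ , λ p → ≋-trans (⊗-comm p oneᴾ) (⊗-identityˡ p)
      ; distrib = ⊗-distribˡ , ⊗-distribʳ }
    ; *-comm = ⊗-comm } }

-- The ring solver uses this test to discard vanishing coefficients. Nonempty lists of zeros also
-- represent zero, hence the recursion.
zero? : ∀ p → Maybe ([] ≋ p)
zero? []      = just ≋-refl
zero? (a ∷ p) with a ℤ.≟ 0ℤ
... | yes a≡0 = Maybe.map (λ e → ≋-trans (≋-sym 0∷[]) (∷-cong (sym a≡0) e)) (zero? p)
... | no  _   = nothing

polySolverRing : AlmostCommutativeRing 0ℓ 0ℓ
polySolverRing = fromCommutativeRing polyRing zero?

module ≋-Reasoning = SetoidReasoning (CommutativeRing.setoid polyRing)

-- Powers and the binomial expansion.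

const-⊗-const : ∀ a c → const a ⊗ const c ≋ const (a ℤ.* c)
const-⊗-const a c = const-⊗ a (const c)

powᴾ-cong : ∀ {p q} n → p ≋ q → powᴾ p n ≋ powᴾ q n
powᴾ-cong zero    e = ≋-refl
powᴾ-cong (suc n) e = ⊗-cong e (powᴾ-cong n e)

powᴾ-⊗ : ∀ p q n → powᴾ (p ⊗ q) n ≋ powᴾ p n ⊗ powᴾ q n
powᴾ-⊗ p q zero    = ≋-sym (⊗-identityˡ oneᴾ)
powᴾ-⊗ p q (suc n) = ≋-trans (⊗-congʳ (p ⊗ q) (powᴾ-⊗ p q n)) (interchange p q (powᴾ p n) (powᴾ q n))
  where
  interchange : ∀ a b u v → (a ⊗ b) ⊗ (u ⊗ v) ≋ (a ⊗ u) ⊗ (b ⊗ v)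
  interchange = solve-∀ polySolverRing

powᴾ-+ : ∀ p m n → powᴾ p (m + n) ≋ powᴾ p m ⊗ powᴾ p n
powᴾ-+ p zero    n = ≋-sym (⊗-identityˡ _)
powᴾ-+ p (suc m) n = ≋-trans (⊗-congʳ p (powᴾ-+ p m n)) (≋-sym (⊗-assoc p (powᴾ p m) (powᴾ p n)))

powᴾ-one : ∀ n → powᴾ oneᴾ n ≋ oneᴾ
powᴾ-one zero    = ≋-refl
powᴾ-one (suc n) = ≋-trans (⊗-identityˡ _) (powᴾ-one n)

powᴾ-* : ∀ p m n → powᴾ p (m * n) ≋ powᴾ (powᴾ p m) n
powᴾ-* p zero    n = ≋-sym (powᴾ-one n)
powᴾ-* p (suc m) n = ≋-trans (powᴾ-+ p n (m * n))
  (≋-trans (⊗-congʳ (powᴾ p n) (powᴾ-* p m n)) (≋-sym (powᴾ-⊗ p (powᴾ p m) n)))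

powᴾ-const : ∀ a n → powᴾ (const (+ a)) n ≋ const (+ (a ^ n))
powᴾ-const a zero    = ≋-refl
powᴾ-const a (suc n) = ≋-trans (⊗-congʳ (const (+ a)) (powᴾ-const a n))
  (≋-trans (const-⊗-const (+ a) (+ (a ^ n))) (const-cong (sym (ℤ.pos-* a (a ^ n)))))

-- c j is the coefficient of q^j p^(n-j).
homSum : Poly → Poly → ℕ → (ℕ → ℤ) → Poly
homSum p q zero    c = const (c 0)
homSum p q (suc n) c = const (c 0) ⊗ powᴾ p (suc n) ⊕ q ⊗ homSum p q n (c ∘ suc)

homSum-cong : ∀ p q n {c e : ℕ → ℤ} → c ≗ e → homSum p q n c ≋ homSum p q n e
homSum-cong p q zero    c≗e = const-cong (c≗e 0)
homSum-cong p q (suc n) c≗e = ⊕-cong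
  (⊗-congˡ (powᴾ p (suc n)) (const-cong (c≗e 0))) (⊗-congʳ q (homSum-cong p q n (c≗e ∘ suc)))

pascal : (ℕ → ℤ) → ℕ → ℤ
pascal c zero    = c 0
pascal c (suc j) = c j ℤ.+ c (suc j)

-- The top coefficient of the product is `c n`, while `pascal` yields `c n + c (suc n)` there; the
-- hypothesis on `c (suc n)` reconciles the two.
⊕-⊗-homSum : ∀ p q n c → c (suc n) ≡ 0ℤ →
  (p ⊕ q) ⊗ homSum p q n c ≋ homSum p q (suc n) (pascal c)
⊕-⊗-homSum p q zero c c₁≡0 = begin
  (p ⊕ q) ⊗ const (c 0)                                ≈⟨ identity p q (const (c 0)) ⟩
  const (c 0) ⊗ (p ⊗ oneᴾ) ⊕ q ⊗ (const (c 0) ⊕ [])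
    ≈⟨ ⊕-congʳ (const (c 0) ⊗ (p ⊗ oneᴾ)) (⊗-congʳ q (⊕-congʳ (const (c 0)) (≋-trans (≋-sym 0∷[]) (const-cong (sym c₁≡0))))) ⟩
  const (c 0) ⊗ (p ⊗ oneᴾ) ⊕ q ⊗ const (c 0 ℤ.+ c 1)   ∎
  where
  open ≋-Reasoning
  identity : ∀ p q u → (p ⊕ q) ⊗ u ≋ u ⊗ (p ⊗ oneᴾ) ⊕ q ⊗ (u ⊕ [])
  identity = solve-∀ polySolverRing
⊕-⊗-homSum p q (suc n) c c≡0 = begin
  (p ⊕ q) ⊗ (c₀ ⊗ (p ⊗ pⁿ) ⊕ q ⊗ h)                         ≈⟨ identity p q c₀ pⁿ h ⟩
  c₀ ⊗ (p ⊗ (p ⊗ pⁿ)) ⊕ q ⊗ (c₀ ⊗ (p ⊗ pⁿ) ⊕ (p ⊕ q) ⊗ h)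
    ≈⟨ ⊕-congʳ (c₀ ⊗ (p ⊗ (p ⊗ pⁿ))) (⊗-congʳ q (⊕-congʳ (c₀ ⊗ (p ⊗ pⁿ)) (⊕-⊗-homSum p q n (c ∘ suc) c≡0))) ⟩
  c₀ ⊗ (p ⊗ (p ⊗ pⁿ)) ⊕ q ⊗ (c₀ ⊗ (p ⊗ pⁿ) ⊕ (c₁ ⊗ (p ⊗ pⁿ) ⊕ q ⊗ h′))
    ≈⟨ identity′ p q c₀ c₁ pⁿ h′ ⟩
  c₀ ⊗ (p ⊗ (p ⊗ pⁿ)) ⊕ q ⊗ ((c₀ ⊕ c₁) ⊗ (p ⊗ pⁿ) ⊕ q ⊗ h′) ∎
  where
  open ≋-Reasoning
  pⁿ = powᴾ p n
  c₀ = const (c 0)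
  c₁ = const (c 1)
  h  = homSum p q n (c ∘ suc)
  h′ = homSum p q n (pascal (c ∘ suc) ∘ suc)
  identity : ∀ p q u v h → (p ⊕ q) ⊗ (u ⊗ (p ⊗ v) ⊕ q ⊗ h) ≋
    u ⊗ (p ⊗ (p ⊗ v)) ⊕ q ⊗ (u ⊗ (p ⊗ v) ⊕ (p ⊕ q) ⊗ h)
  identity = solve-∀ polySolverRing
  identity′ : ∀ p q u u′ v h → u ⊗ (p ⊗ (p ⊗ v)) ⊕ q ⊗ (u ⊗ (p ⊗ v) ⊕ (u′ ⊗ (p ⊗ v) ⊕ q ⊗ h)) ≋
    u ⊗ (p ⊗ (p ⊗ v)) ⊕ q ⊗ ((u ⊕ u′) ⊗ (p ⊗ v) ⊕ q ⊗ h)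
  identity′ = solve-∀ polySolverRing

pascal-C : ∀ n → pascal (λ j → + (n C j)) ≗ (λ j → + (suc n C j))
pascal-C n zero    = refl
pascal-C n (suc j) = cong +_ (nCk+nC[k+1]≡[n+1]C[k+1] n j)

binomial : ∀ p q n → powᴾ (p ⊕ q) n ≋ homSum p q n (λ j → + (n C j))
binomial p q zero    = ≋-refl
binomial p q (suc n) = ≋-trans (⊗-congʳ (p ⊕ q) (binomial p q n))
  (≋-trans (⊕-⊗-homSum p q n (λ j → + (n C j)) (cong +_ (k>n⇒nCk≡0 (ℕ.n<1+n n))))
           (homSum-cong p q (suc n) (pascal-C n)))

-- This is (p+q)^(k+2) without its terms of degree 0 and 1 in q, divided by q²; the explicit sum
-- makes the division unnecessary.
quadraticPart : Poly → Poly → ℕ → Poly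
quadraticPart p q k = homSum p q k (λ j → + (suc (suc k) C suc (suc j)))

binomial₂ : ∀ p q k → powᴾ (p ⊕ q) (suc (suc k)) ≋
  powᴾ p (suc (suc k)) ⊕ const (+ suc (suc k)) ⊗ (q ⊗ powᴾ p (suc k)) ⊕ q ⊗ q ⊗ quadraticPart p q k
binomial₂ p q k = ≋-trans (binomial p q (suc (suc k)))
  (≋-trans (⊕-congʳ (oneᴾ ⊗ powᴾ p (suc (suc k))) (⊗-congʳ q (⊕-congˡ (q ⊗ quadraticPart p q k)
    (⊗-congˡ (powᴾ p (suc k)) (const-cong (cong +_ (nC1≡n (suc (suc k)))))))))
           (identity q (powᴾ p (suc (suc k))) (powᴾ p (suc k)) (const (+ suc (suc k))) (quadraticPart p q k)))
  where
  identity : ∀ q u v c h → oneᴾ ⊗ u ⊕ q ⊗ (c ⊗ v ⊕ q ⊗ h) ≋ u ⊕ c ⊗ (q ⊗ v) ⊕ q ⊗ q ⊗ h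
  identity = solve-∀ polySolverRing

-- The recursion for τ and the division that defines 𝒢.

module Dynamics (k : ℕ) where

  d : ℕ
  d = suc (suc k)

  c-d c-d-1 : Poly
  c-d   = const (+ d)
  c-d-1 = const (+ suc k)

  -- σₙ n, τₙ n, θ n and G n have index m = n + 1 in the paper.
  rₙ sₙ σₙ τₙ θ G : ℕ → Poly
  rₙ n = r d n
  sₙ n = s d n
  σₙ n = σ d (suc n)
  τₙ n = τ d (suc n)

  remainder : ℕ → Poly
  remainder n = quadraticPart (σₙ n) (τₙ n) k

  -- τₙ n = b d θ n, which makes the division by b d in the definition of 𝒢 explicit.
  θ zero    = negᴾ oneᴾ
  θ (suc n) = bd d ⊗ (G n ⊗ θ n)
  G n = negᴾ (c-d-1 ⊗ powᴾ (σₙ n) (suc k)) ⊖ bd+1 d ⊗ (θ n ⊗ remainder n)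

  c-d≋ : c-d ≋ c-d-1 ⊕ oneᴾ
  c-d≋ = const-cong (cong +_ (ℕ.+-comm 1 (suc k)))

  -- The coefficient of s^d is (d-1) - (b+1)d = -(bd+1), which is where the factor bd+1 of 𝒢
  -- originates.
  τ≋ : ∀ n → τₙ n ≋ powᴾ (rₙ n) d ⊖ bd+1 d ⊗ powᴾ (sₙ n) d
  τ≋ n = begin
    u ⊕ c-d-1 ⊗ v ⊖ b+1 ⊗ c-d ⊗ v                   ≈⟨ ⊖-congʳ (u ⊕ c-d-1 ⊗ v) (⊗-congˡ v (⊗-congʳ b+1 c-d≋)) ⟩
    u ⊕ c-d-1 ⊗ v ⊖ b+1 ⊗ (c-d-1 ⊕ oneᴾ) ⊗ v        ≈⟨ identity u v X c-d-1 ⟩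
    u ⊖ ((c-d-1 ⊕ oneᴾ) ⊗ X ⊕ oneᴾ) ⊗ v             ≈⟨ ⊖-congʳ u (⊗-congˡ v (⊕-congˡ oneᴾ (⊗-congˡ X c-d≋))) ⟨
    u ⊖ bd+1 d ⊗ v                                  ∎
    where
    open ≋-Reasoning
    u = powᴾ (rₙ n) d
    v = powᴾ (sₙ n) d
    identity : ∀ u v x c → u ⊕ c ⊗ v ⊖ (x ⊕ oneᴾ) ⊗ (c ⊕ oneᴾ) ⊗ v ≋ u ⊖ ((c ⊕ oneᴾ) ⊗ x ⊕ oneᴾ) ⊗ v
    identity = solve-∀ polySolverRing

  -- The first term of 𝒢. It plays two roles: it is the factor by which r^d grows in one step, and
  -- multiplied by s^d it gives σ^d.
  W : ℕ → Poly
  W n = powᴾ b+1 d ⊗ const (+ (d ^ d)) ⊗ powᴾ (sₙ n) (d * suc k)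

  W≋ : ∀ n → W n ≋ b+1 ⊗ c-d ⊗ powᴾ (σₙ n) (suc k)
  W≋ n = ≋-sym (begin
    b+1 ⊗ c-d ⊗ powᴾ (b+1 ⊗ c-d ⊗ S) (suc k)              ≈⟨ ⊗-congʳ (b+1 ⊗ c-d) (powᴾ-⊗ (b+1 ⊗ c-d) S (suc k)) ⟩
    b+1 ⊗ c-d ⊗ (powᴾ (b+1 ⊗ c-d) (suc k) ⊗ powᴾ S (suc k)) ≈⟨ ⊗-assoc (b+1 ⊗ c-d) (powᴾ (b+1 ⊗ c-d) (suc k)) (powᴾ S (suc k)) ⟨
    powᴾ (b+1 ⊗ c-d) d ⊗ powᴾ S (suc k)
      ≈⟨ ⊗-cong (≋-trans (powᴾ-⊗ b+1 c-d d) (⊗-congʳ (powᴾ b+1 d) (powᴾ-const d d))) (≋-sym (powᴾ-* (sₙ n) d (suc k))) ⟩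
    W n                                                   ∎)
    where
    open ≋-Reasoning
    S = powᴾ (sₙ n) d

  r-power : ∀ n → powᴾ (rₙ (suc n)) d ≋ W n ⊗ powᴾ (rₙ n) d
  r-power n = begin
    powᴾ (b+1 ⊗ c-d ⊗ r′ ⊗ S) d                            ≈⟨ powᴾ-⊗ (b+1 ⊗ c-d ⊗ r′) S d ⟩
    powᴾ (b+1 ⊗ c-d ⊗ r′) d ⊗ powᴾ S d                     ≈⟨ ⊗-congˡ (powᴾ S d) (powᴾ-⊗ (b+1 ⊗ c-d) r′ d) ⟩
    powᴾ (b+1 ⊗ c-d) d ⊗ powᴾ r′ d ⊗ powᴾ S d
      ≈⟨ ⊗-cong (⊗-congˡ (powᴾ r′ d) (≋-trans (powᴾ-⊗ b+1 c-d d) (⊗-congʳ (powᴾ b+1 d) (powᴾ-const d d))))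
                (≋-trans (≋-sym (powᴾ-* (sₙ n) (suc k) d)) (≋-reflexive (cong (powᴾ (sₙ n)) (ℕ.*-comm (suc k) d)))) ⟩
    powᴾ b+1 d ⊗ const (+ (d ^ d)) ⊗ powᴾ r′ d ⊗ powᴾ (sₙ n) (d * suc k)
      ≈⟨ swap (powᴾ b+1 d ⊗ const (+ (d ^ d))) (powᴾ r′ d) (powᴾ (sₙ n) (d * suc k)) ⟩
    W n ⊗ powᴾ r′ d ∎
    where
    open ≋-Reasoning
    r′ = rₙ n
    S = powᴾ (sₙ n) (suc k)
    swap : ∀ a b c → a ⊗ b ⊗ c ≋ a ⊗ c ⊗ b
    swap = solve-∀ polySolverRing

  s≋σ⊕τ : ∀ n → sₙ (suc n) ≋ σₙ n ⊕ τₙ n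
  s≋σ⊕τ n = identity (sₙ (suc n)) (σₙ n)
    where
    identity : ∀ x y → x ≋ y ⊕ (x ⊖ y)
    identity = solve-∀ polySolverRing

  numerator : ℕ → Poly
  numerator n = W n ⊗ τₙ n ⊖ bd+1 d ⊗ (powᴾ (sₙ (suc n)) d ⊖ powᴾ (σₙ n) d)

  -- In `τ≋` at the next index, `r-power` brings back the old r^d, which is `τₙ n` plus (bd+1) s^d.
  -- The leftover `W n` times s^d is σ^d.
  τ-suc : ∀ n → τₙ (suc n) ≋ numerator n
  τ-suc n = begin
    τₙ (suc n)                                          ≈⟨ τ≋ (suc n) ⟩
    powᴾ (rₙ (suc n)) d ⊖ bd+1 d ⊗ sᵈ                   ≈⟨ ⊕-congˡ (negᴾ (bd+1 d ⊗ sᵈ)) (r-power n) ⟩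
    W n ⊗ powᴾ (rₙ n) d ⊖ bd+1 d ⊗ sᵈ                   ≈⟨ ⊕-congˡ (negᴾ (bd+1 d ⊗ sᵈ)) (⊗-congʳ (W n) (identity (powᴾ (rₙ n) d) (bd+1 d ⊗ Sᵈ))) ⟩
    W n ⊗ ((powᴾ (rₙ n) d ⊖ bd+1 d ⊗ Sᵈ) ⊕ bd+1 d ⊗ Sᵈ) ⊖ bd+1 d ⊗ sᵈ
      ≈⟨ ⊕-congˡ (negᴾ (bd+1 d ⊗ sᵈ)) (⊗-congʳ (W n) (⊕-congˡ (bd+1 d ⊗ Sᵈ) (≋-sym (τ≋ n)))) ⟩
    W n ⊗ (τₙ n ⊕ bd+1 d ⊗ Sᵈ) ⊖ bd+1 d ⊗ sᵈ            ≈⟨ identity′ (W n) (τₙ n) (bd+1 d) Sᵈ sᵈ ⟩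
    W n ⊗ τₙ n ⊖ bd+1 d ⊗ (sᵈ ⊖ W n ⊗ Sᵈ)               ≈⟨ ⊖-congʳ (W n ⊗ τₙ n) (⊗-congʳ (bd+1 d) (⊖-congʳ sᵈ W⊗Sᵈ)) ⟩
    numerator n                                         ∎
    where
    open ≋-Reasoning
    sᵈ = powᴾ (sₙ (suc n)) d
    Sᵈ = powᴾ (sₙ n) d
    identity : ∀ x y → x ≋ (x ⊖ y) ⊕ y
    identity = solve-∀ polySolverRing
    identity′ : ∀ w t e u v → w ⊗ (t ⊕ e ⊗ u) ⊖ e ⊗ v ≋ w ⊗ t ⊖ e ⊗ (v ⊖ w ⊗ u)
    identity′ = solve-∀ polySolverRing
    swap : ∀ a b c → a ⊗ b ⊗ c ≋ a ⊗ c ⊗ b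
    swap = solve-∀ polySolverRing
    W⊗Sᵈ : W n ⊗ Sᵈ ≋ powᴾ (σₙ n) d
    W⊗Sᵈ = ≋-trans (⊗-congˡ Sᵈ (W≋ n)) (swap (b+1 ⊗ c-d) (powᴾ (σₙ n) (suc k)) Sᵈ)

  -- After the binomial expansion the σ^d terms cancel, the terms linear in τ combine to (b+1)d -
  -- (bd+1)d = -bd(d-1), and in the rest one factor τ is replaced by bd θ. So bd divides everything.
  numerator≋ : ∀ n → τₙ n ≋ bd d ⊗ θ n → numerator n ≋ bd d ⊗ G n ⊗ τₙ n
  numerator≋ n τ≋bdθ = begin
    W n ⊗ t ⊖ bd+1 d ⊗ (powᴾ (sₙ (suc n)) d ⊖ σₙ n ⊗ Q)
      ≈⟨ ⊕-cong (⊗-congˡ t (W≋ n)) (negᴾ-cong (⊗-congʳ (bd+1 d) (⊕-congˡ (negᴾ (σₙ n ⊗ Q))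
           (≋-trans (powᴾ-cong d (s≋σ⊕τ n)) (binomial₂ (σₙ n) t k))))) ⟩
    b+1 ⊗ c-d ⊗ Q ⊗ t ⊖ bd+1 d ⊗ (σₙ n ⊗ Q ⊕ c-d ⊗ (t ⊗ Q) ⊕ t ⊗ t ⊗ R ⊖ σₙ n ⊗ Q)
      ≈⟨ identity X c-d Q t (σₙ n) R ⟩
    negᴾ (bd d ⊗ ((c-d ⊖ oneᴾ) ⊗ Q)) ⊗ t ⊖ bd+1 d ⊗ (t ⊗ R) ⊗ t
      ≈⟨ ⊖-congʳ (negᴾ (bd d ⊗ ((c-d ⊖ oneᴾ) ⊗ Q)) ⊗ t) (⊗-congˡ t (⊗-congʳ (bd+1 d) (⊗-congˡ R τ≋bdθ))) ⟩
    negᴾ (bd d ⊗ ((c-d ⊖ oneᴾ) ⊗ Q)) ⊗ t ⊖ bd+1 d ⊗ (bd d ⊗ θ n ⊗ R) ⊗ t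
      ≈⟨ identity′ (bd d) (bd+1 d) (c-d ⊖ oneᴾ) Q t (θ n) R ⟩
    bd d ⊗ (negᴾ ((c-d ⊖ oneᴾ) ⊗ Q) ⊖ bd+1 d ⊗ (θ n ⊗ R)) ⊗ t
      -- `c-d ⊖ oneᴾ` computes to `c-d-1`, so reflexivity suffices.
      ≈⟨ ⊗-congˡ t (⊗-congʳ (bd d) (⊕-congˡ (negᴾ (bd+1 d ⊗ (θ n ⊗ R))) (negᴾ-cong (≋-refl {c-d-1 ⊗ Q})))) ⟩
    bd d ⊗ G n ⊗ t ∎
    where
    open ≋-Reasoning
    t = τₙ n
    Q = powᴾ (σₙ n) (suc k)
    R = remainder n
    identity : ∀ x c Q t s R →
      (x ⊕ oneᴾ) ⊗ c ⊗ Q ⊗ t ⊖ (c ⊗ x ⊕ oneᴾ) ⊗ (s ⊗ Q ⊕ c ⊗ (t ⊗ Q) ⊕ t ⊗ t ⊗ R ⊖ s ⊗ Q) ≋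
      negᴾ (c ⊗ x ⊗ ((c ⊖ oneᴾ) ⊗ Q)) ⊗ t ⊖ (c ⊗ x ⊕ oneᴾ) ⊗ (t ⊗ R) ⊗ t
    identity = solve-∀ polySolverRing
    identity′ : ∀ e e′ c Q t θ R →
      negᴾ (e ⊗ (c ⊗ Q)) ⊗ t ⊖ e′ ⊗ (e ⊗ θ ⊗ R) ⊗ t ≋ e ⊗ (negᴾ (c ⊗ Q) ⊖ e′ ⊗ (θ ⊗ R)) ⊗ t
    identity′ = solve-∀ polySolverRing

  τ≋bdθ : ∀ n → τₙ n ≋ bd d ⊗ θ n
  τ≋bdθ zero    = begin
    τₙ 0                                         ≈⟨ τ≋ 0 ⟩
    powᴾ oneᴾ d ⊖ bd+1 d ⊗ powᴾ oneᴾ d           ≈⟨ ⊕-cong (powᴾ-one d) (negᴾ-cong (⊗-congʳ (bd+1 d) (powᴾ-one d))) ⟩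
    oneᴾ ⊖ (bd d ⊕ oneᴾ) ⊗ oneᴾ                  ≈⟨ identity (bd d) ⟩
    bd d ⊗ negᴾ oneᴾ                             ∎
    where
    open ≋-Reasoning
    identity : ∀ x → oneᴾ ⊖ (x ⊕ oneᴾ) ⊗ oneᴾ ≋ x ⊗ negᴾ oneᴾ
    identity = solve-∀ polySolverRing
  τ≋bdθ (suc n) = begin
    τₙ (suc n)                   ≈⟨ τ-suc n ⟩
    numerator n                  ≈⟨ numerator≋ n (τ≋bdθ n) ⟩
    bd d ⊗ G n ⊗ τₙ n            ≈⟨ ⊗-congʳ (bd d ⊗ G n) (τ≋bdθ n) ⟩
    bd d ⊗ G n ⊗ (bd d ⊗ θ n)    ≈⟨ identity (bd d) (G n) (θ n) ⟩
    bd d ⊗ θ (suc n)             ∎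
    where
    open ≋-Reasoning
    identity : ∀ x g t → x ⊗ g ⊗ (x ⊗ t) ≋ x ⊗ (x ⊗ (g ⊗ t))
    identity = solve-∀ polySolverRing

  τ-step : ∀ n → τₙ (suc n) ≋ bd d ⊗ G n ⊗ τₙ n
  τ-step n = ≋-trans (τ-suc n) (numerator≋ n (τ≋bdθ n))

  isGm : ∀ n → IsGm d (suc n) (G n)
  isGm n = coeffs (≋-sym (numerator≋ n (τ≋bdθ n)))

-- Monomials and divisibility by prime powers.

monomial : ℕ → ℤ → Poly
monomial zero    c = const c
monomial (suc i) c = 0ℤ ∷ monomial i c

coeff-monomial : ∀ i c → coeff (monomial i c) i ≡ c
coeff-monomial zero    c = refl
coeff-monomial (suc i) c = coeff-monomial i c

coeff-monomial-≢ : ∀ i j c → j ≢ i → coeff (monomial i c) j ≡ 0ℤ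
coeff-monomial-≢ zero    zero    c j≢i = ⊥-elim (j≢i refl)
coeff-monomial-≢ zero    (suc j) c j≢i = refl
coeff-monomial-≢ (suc i) zero    c j≢i = refl
coeff-monomial-≢ (suc i) (suc j) c j≢i = coeff-monomial-≢ i j c (j≢i ∘ cong suc)

scale-monomial : ∀ a j c → scale a (monomial j c) ≋ monomial j (a ℤ.* c)
scale-monomial a zero    c = ≋-refl
scale-monomial a (suc j) c = ∷-cong (ℤ.*-zeroʳ a) (scale-monomial a j c)

monomial-⊗ : ∀ i j a c → monomial i a ⊗ monomial j c ≋ monomial (i + j) (a ℤ.* c)
monomial-⊗ zero    j a c = ≋-trans (const-⊗ a (monomial j c)) (scale-monomial a j c)
monomial-⊗ (suc i) j a c = ≋-trans (0∷-⊗ (monomial i a) (monomial j c)) (∷-cong refl (monomial-⊗ i j a c))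

^-∣-^ : ∀ d {u v} → u ≤ v → + (d ^ u) ∣ + (d ^ v)
^-∣-^ d {u} {v} u≤v with ℕ.m≤n⇒∃[o]m+o≡n u≤v
... | o , refl = divides (+ (d ^ o)) (begin
  + (d ^ (u + o))             ≡⟨ cong +_ (ℕ.^-distribˡ-+-* d u o) ⟩
  + (d ^ u * d ^ o)           ≡⟨ cong +_ (ℕ.*-comm (d ^ u) (d ^ o)) ⟩
  + (d ^ o * d ^ u)           ≡⟨ ℤ.pos-* (d ^ o) (d ^ u) ⟩
  + (d ^ o) ℤ.* + (d ^ u)     ∎)
  where open ≡-Reasoning

^-∣-* : ∀ d u v {x y} → + (d ^ u) ∣ x → + (d ^ v) ∣ y → + (d ^ (u + v)) ∣ x ℤ.* y
^-∣-* d u v (divides q refl) (divides q′ refl) = divides (q ℤ.* q′) (begin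
  q ℤ.* + (d ^ u) ℤ.* (q′ ℤ.* + (d ^ v))       ≡⟨ interchange q (+ (d ^ u)) q′ (+ (d ^ v)) ⟩
  q ℤ.* q′ ℤ.* (+ (d ^ u) ℤ.* + (d ^ v))       ≡⟨ cong (q ℤ.* q′ ℤ.*_) (ℤ.pos-* (d ^ u) (d ^ v)) ⟨
  q ℤ.* q′ ℤ.* + (d ^ u * d ^ v)               ≡⟨ cong (λ z → q ℤ.* q′ ℤ.* + z) (ℕ.^-distribˡ-+-* d u v) ⟨
  q ℤ.* q′ ℤ.* + (d ^ (u + v))                 ∎)
  where
  open ≡-Reasoning
  interchange : ∀ a b c e → a ℤ.* b ℤ.* (c ℤ.* e) ≡ a ℤ.* c ℤ.* (b ℤ.* e)
  interchange = ℤ-Solver.solve-∀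

∣0 : ∀ i → i ∣ 0ℤ
∣0 i = divides 0ℤ (sym (ℤ.*-zeroˡ i))

-- Valuations, weighted filtrations and leading terms.

module Valuation {p : ℕ} (prime : Prime p) where

  instance
    p-nonZero : NonZero p
    p-nonZero = prime⇒nonZero prime

  ∣-cancel-^ : ∀ {c} v → + (p ^ suc v) ∣ c ℤ.* + (p ^ v) → + p ∣ c
  ∣-cancel-^ {c} v pᵛ⁺¹∣ = *-cancelʳ-∣ (+ (p ^ v)) {+ p} {c} {{ℕ.m^n≢0 p v}}
    (subst (λ z → z ∣ c ℤ.* + (p ^ v)) (ℤ.pos-* p (p ^ v)) pᵛ⁺¹∣)

  hasVal⁺ : ∀ {a c z} v → ¬ (+ p ∣ c) → a ≡ c ℤ.* + (p ^ v) ℤ.+ z → + (p ^ suc v) ∣ z → HasVal p a v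
  hasVal⁺ {a} {c} {z} v p∤c a≡ pᵛ⁺¹∣z =
      (λ a≡0 → not-∣ (subst (+ (p ^ suc v) ∣_) (sym a≡0) (∣0 _)))
    , ∣⇒∣ᵤ (subst (+ (p ^ v) ∣_) (sym a≡) (∣m∣n⇒∣m+n (divides c refl) (∣-trans (^-∣-^ p (ℕ.n≤1+n v)) pᵛ⁺¹∣z)))
    , not-∣ ∘ ∣ᵤ⇒∣
    where
    not-∣ : ¬ (+ (p ^ suc v) ∣ a)
    not-∣ pᵛ⁺¹∣a = p∤c (∣-cancel-^ v (∣m+n∣n⇒∣m (subst (+ (p ^ suc v) ∣_) a≡ pᵛ⁺¹∣a) pᵛ⁺¹∣z))

  hasVal⁻ : ∀ {a v} → HasVal p a v → Σ[ c ∈ ℤ ] (¬ (+ p ∣ c) × a ≡ c ℤ.* + (p ^ v))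
  hasVal⁻ {a} {v} (a≢0 , pᵛ∣a , pᵛ⁺¹∤a) with ∣ᵤ⇒∣ {+ (p ^ v)} {a} pᵛ∣a
  ... | divides c refl = c , (λ p∣c → pᵛ⁺¹∤a (∣⇒∣ᵤ (subst (_∣ c ℤ.* + (p ^ v)) (sym (ℤ.pos-* p (p ^ v)))
      (*-monoˡ-∣ (+ (p ^ v)) p∣c)))) , refl

  hasVal-maximal : ∀ {a u v} → + (p ^ u) ∣ a → HasVal p a v → u ≤ v
  hasVal-maximal {a} {u} {v} pᵘ∣a (_ , _ , pᵛ⁺¹∤a) with u ℕ.≤? v
  ... | yes u≤v = u≤v
  ... | no  u≰v = ⊥-elim (pᵛ⁺¹∤a (∣⇒∣ᵤ (∣-trans (^-∣-^ p (ℕ.≰⇒> u≰v)) pᵘ∣a)))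

  -- Euclid's lemma is what makes leading terms multiplicative.
  ∤-* : ∀ {a c} → ¬ (+ p ∣ a) → ¬ (+ p ∣ c) → ¬ (+ p ∣ a ℤ.* c)
  ∤-* {a} {c} p∤a p∤c p∣ac =
    [ p∤a ∘ ∣ᵤ⇒∣ , p∤c ∘ ∣ᵤ⇒∣ ]′ (euclidsLemma ∣ a ∣ ∣ c ∣ prime (subst (p ℕ∣.∣_) (ℤ.abs-* a c) (∣⇒∣ᵤ p∣ac)))

  ∤1 : ¬ (+ p ∣ 1ℤ)
  ∤1 p∣1 = ℕ.<⇒≱ (ℕ.nonTrivial⇒n>1 p {{prime⇒nonTrivial prime}}) (ℕ∣.∣⇒≤ (∣⇒∣ᵤ p∣1))

  -- Filt a is the ideal of polynomials all of whose monomials have weight at least a,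
  -- where p has weight wd and the variable has weight wb.
  module Weighted (wd wb : ℕ) {{_ : NonZero wd}} where

    weight : ℕ → ℕ → ℕ
    weight i v = wd * v + wb * i

    record Filt (a : ℕ) (f : Poly) : Set where
      constructor filt
      field bound : ∀ i → Σ[ v ∈ ℕ ] (+ (p ^ v) ∣ coeff f i × a ≤ weight i v)
    open Filt public

    v≤wd*v : ∀ v → v ≤ wd * v
    v≤wd*v v = ℕ.m≤n*m v wd

    -- A zero coefficient has infinite valuation, so any exponent may be claimed; `a` itself is
    -- large enough because `wd` is at least 1.
    ∣0-bound : ∀ a i → Σ[ v ∈ ℕ ] (+ (p ^ v) ∣ 0ℤ × a ≤ weight i v)
    ∣0-bound a i = a , ∣0 _ , ℕ.≤-trans (v≤wd*v a) (ℕ.m≤m+n _ _)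

    Filt-≋ : ∀ {a f g} → f ≋ g → Filt a f → Filt a g
    Filt-≋ (mk e) (filt h) = filt λ i → let v , pᵛ∣ , a≤ = h i in v , subst (+ (p ^ v) ∣_) (e i) pᵛ∣ , a≤

    Filt-mono : ∀ {a a′ f} → a ≤ a′ → Filt a′ f → Filt a f
    Filt-mono a≤a′ (filt h) = filt λ i → let v , pᵛ∣ , a′≤ = h i in v , pᵛ∣ , ℕ.≤-trans a≤a′ a′≤

    Filt-⊕ : ∀ {a f g} → Filt a f → Filt a g → Filt a (f ⊕ g)
    Filt-⊕ {a} {f} {g} (filt h) (filt h′) = filt sum
      where
      sum : ∀ i → Σ[ v ∈ ℕ ] (+ (p ^ v) ∣ coeff (f ⊕ g) i × a ≤ weight i v)
      sum i with h i | h′ i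
      ... | u , pᵘ∣ , a≤u | v , pᵛ∣ , a≤v with ℕ.≤-total u v
      ... | inj₁ u≤v = u , subst (+ (p ^ u) ∣_) (sym (coeff-⊕ f g i)) (∣m∣n⇒∣m+n pᵘ∣ (∣-trans (^-∣-^ p u≤v) pᵛ∣)) , a≤u
      ... | inj₂ v≤u = v , subst (+ (p ^ v) ∣_) (sym (coeff-⊕ f g i)) (∣m∣n⇒∣m+n (∣-trans (^-∣-^ p v≤u) pᵘ∣) pᵛ∣) , a≤v

    Filt-neg : ∀ {a f} → Filt a f → Filt a (negᴾ f)
    Filt-neg {f = f} (filt h) = filt λ i → let v , pᵛ∣ , a≤ = h i in
      v , subst (+ (p ^ v) ∣_) (sym (coeff-neg f i)) (∣m⇒∣-m pᵛ∣) , a≤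

    Filt-⊖ : ∀ {a f g} → Filt a f → Filt a g → Filt a (f ⊖ g)
    Filt-⊖ h h′ = Filt-⊕ h (Filt-neg h′)

    Filt-[] : ∀ {a} → Filt a []
    Filt-[] {a} = filt (∣0-bound a)

    Filt-∷ : ∀ {a c f} v → + (p ^ v) ∣ c → a ≤ weight 0 v → Filt (a ∸ wb) f → Filt a (c ∷ f)
    Filt-∷ {a} {c} {f} v pᵛ∣c a≤ (filt h) = filt bounds
      where
      open ℕ.≤-Reasoning
      shift : ∀ wd wb u i → wb + (wd * u + wb * i) ≡ wd * u + wb * (1 + i)
      shift = ℕ-Solver.solve-∀
      bounds : ∀ i → Σ[ u ∈ ℕ ] (+ (p ^ u) ∣ coeff (c ∷ f) i × a ≤ weight i u)
      bounds zero    = v , pᵛ∣c , a≤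
      bounds (suc i) = let u , pᵘ∣ , a∸wb≤ = h i in u , pᵘ∣ , (begin
        a                       ≤⟨ ℕ.m≤n+m∸n a wb ⟩
        wb + (a ∸ wb)           ≤⟨ ℕ.+-monoʳ-≤ wb a∸wb≤ ⟩
        wb + (wd * u + wb * i)  ≡⟨ shift wd wb u i ⟩
        wd * u + wb * suc i     ∎)

    Filt-tail : ∀ {a c f} → Filt a (c ∷ f) → Filt (a ∸ wb) f
    Filt-tail {a} (filt h) = filt λ i → let v , pᵛ∣ , a≤ = h (suc i) in
      v , pᵛ∣ , ℕ.m≤n+o⇒m∸n≤o a wb (ℕ.≤-trans a≤ (ℕ.≤-reflexive (shift wd wb v i)))
      where
      shift : ∀ wd wb u i → wd * u + wb * (1 + i) ≡ wb + (wd * u + wb * i)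
      shift = ℕ-Solver.solve-∀

    Filt-scale : ∀ {a b c g} u → + (p ^ u) ∣ c → a ≤ wd * u → Filt b g → Filt (a + b) (scale c g)
    Filt-scale {a} {b} {c} {g} u pᵘ∣c a≤ (filt h) = filt λ i → let v , pᵛ∣ , b≤ = h i in
      u + v , subst (+ (p ^ (u + v)) ∣_) (sym (coeff-scale c g i)) (^-∣-* p u v pᵘ∣c pᵛ∣) , (begin
        a + b                          ≤⟨ ℕ.+-mono-≤ a≤ b≤ ⟩
        wd * u + (wd * v + wb * i)     ≡⟨ regroup wd u v (wb * i) ⟩
        weight i (u + v)               ∎)
      where
      open ℕ.≤-Reasoning
      regroup : ∀ w u v z → w * u + (w * v + z) ≡ w * (u + v) + z
      regroup = ℕ-Solver.solve-∀

    Filt-⊗ : ∀ {a b f g} → Filt a f → Filt b g → Filt (a + b) (f ⊗ g)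
    Filt-⊗ {f = []}             _ _ = Filt-[]
    Filt-⊗ {a} {b} {c ∷ f} {g} h h′ with bound h 0
    ... | u , pᵘ∣ , a≤ = Filt-⊕
      (Filt-scale u pᵘ∣ (subst (a ≤_) (trans (cong (λ z → wd * u + z) (ℕ.*-zeroʳ wb)) (ℕ.+-identityʳ _)) a≤) h′)
      (Filt-∷ (proj₁ zero-bound) (proj₁ (proj₂ zero-bound)) (proj₂ (proj₂ zero-bound)) (Filt-mono a+b∸wb≤ (Filt-⊗ (Filt-tail h) h′)))
      where
      zero-bound = ∣0-bound (a + b) 0
      a+b∸wb≤ : a + b ∸ wb ≤ (a ∸ wb) + b
      a+b∸wb≤ = ℕ.m≤n+o⇒m∸n≤o (a + b) wb (begin
        a + b                ≤⟨ ℕ.+-monoˡ-≤ b (ℕ.m≤n+m∸n a wb) ⟩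
        wb + (a ∸ wb) + b    ≡⟨ ℕ.+-assoc wb (a ∸ wb) b ⟩
        wb + ((a ∸ wb) + b)  ∎)
        where open ℕ.≤-Reasoning

    Filt-const : ∀ {a c} v → + (p ^ v) ∣ c → a ≤ wd * v → Filt a (const c)
    Filt-const v pᵛ∣c a≤ = Filt-∷ v pᵛ∣c (ℕ.≤-trans a≤ (ℕ.m≤m+n _ _)) Filt-[]

    Filt-zero : ∀ f → Filt 0 f
    Filt-zero f = filt λ i → 0 , divides (coeff f i) (sym (ℤ.*-identityʳ _)) , z≤n

    Filt-pow : ∀ {a f} n → Filt a f → Filt (n * a) (powᴾ f n)
    Filt-pow zero    h = Filt-zero oneᴾ
    Filt-pow (suc n) h = Filt-⊗ h (Filt-pow n h)

    Filt-monomial : ∀ i v c → Filt (weight i v) (monomial i (c ℤ.* + (p ^ v)))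
    Filt-monomial i v c = filt bounds
      where
      bounds : ∀ j → Σ[ u ∈ ℕ ] (+ (p ^ u) ∣ coeff (monomial i (c ℤ.* + (p ^ v))) j × weight i v ≤ weight j u)
      bounds j with j ℕ.≟ i
      ... | yes refl = v , subst (+ (p ^ v) ∣_) (sym (coeff-monomial j _)) (divides c refl) , ℕ.≤-refl
      ... | no  j≢i rewrite coeff-monomial-≢ i j (c ℤ.* + (p ^ v)) j≢i = ∣0-bound (weight i v) j

    Filt-homSum : ∀ {a f g} n c → Filt a f → Filt a g → Filt (n * a) (homSum f g n c)
    Filt-homSum zero    c h h′ = Filt-zero _
    Filt-homSum (suc n) c h h′ = Filt-⊕
      (Filt-⊗ (Filt-zero (const (c 0))) (Filt-pow (suc n) h))
      (Filt-⊗ h′ (Filt-homSum n (c ∘ suc) h h′))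

    -- Every term except g^n has a coefficient divisible by p and so gains the weight `wd`.
    Filt-homSum-⊖ : ∀ {a f g} n c → (∀ j → j < n → + p ∣ c j) → c n ≡ 1ℤ →
      Filt a f → Filt a g → Filt (wd + n * a) (homSum f g n c ⊖ powᴾ g n)
    Filt-homSum-⊖ zero c p∣ c₀≡1 h h′ =
      Filt-≋ (≋-sym (≋-trans (⊕-congˡ (negᴾ oneᴾ) (const-cong c₀≡1)) (⊕-inverseʳ oneᴾ))) Filt-[]
    Filt-homSum-⊖ {a} {f} {g} (suc n) c p∣ c≡1 h h′ = Filt-≋
      (identity (const (c 0) ⊗ powᴾ f (suc n)) g (homSum f g n (c ∘ suc)) (powᴾ g n))
      (Filt-⊕ (Filt-⊗ (Filt-const 1 (subst (λ z → + z ∣ c 0) (sym (ℕ.^-identityʳ p)) (p∣ 0 ℕ.z<s)) (ℕ.≤-reflexive (sym (ℕ.*-identityʳ wd))))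
                      (Filt-pow (suc n) h))
              (Filt-mono (ℕ.≤-reflexive (regroup wd a (n * a)))
                (Filt-⊗ h′ (Filt-homSum-⊖ n (c ∘ suc) (λ j j<n → p∣ (suc j) (ℕ.s<s j<n)) c≡1 h h′))))
      where
      identity : ∀ u g s q → u ⊕ g ⊗ (s ⊖ q) ≋ u ⊕ g ⊗ s ⊖ g ⊗ q
      identity = solve-∀ polySolverRing
      regroup : ∀ w a b → w + (a + b) ≡ a + (w + b)
      regroup = ℕ-Solver.solve-∀

    -- `ε` is the weight gap between the leading monomial and everything else. A positive gap
    -- isolates the monomial; for `ε = 0` ties are allowed and only a lower bound on weights
    -- remains.
    record Leading (ε x y : ℕ) (f : Poly) : Set where
      constructor leading
      field
        lc      : ℤ
        lc-unit : ¬ (+ p ∣ lc)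
        rest    : Filt (weight x y + ε) (f ⊖ monomial x (lc ℤ.* + (p ^ y)))

    Leading-≋ : ∀ {ε x y f g} → f ≋ g → Leading ε x y f → Leading ε x y g
    Leading-≋ f≋g (leading c u h) = leading c u (Filt-≋ (⊕-congˡ _ f≋g) h)

    Leading-perturb : ∀ {ε x y f e} → Leading ε x y f → Filt (weight x y + ε) e → Leading ε x y (f ⊕ e)
    Leading-perturb {f = f} {e} (leading c u h) h′ = leading c u (Filt-≋ (identity f _ e) (Filt-⊕ h h′))
      where
      identity : ∀ f m e → (f ⊖ m) ⊕ e ≋ f ⊕ e ⊖ m
      identity = solve-∀ polySolverRing

    Leading⇒Filt : ∀ {ε x y f} → Leading ε x y f → Filt (weight x y) f
    Leading⇒Filt {x = x} {y} {f} (leading c _ h) = Filt-≋ (identity f _)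
      (Filt-⊕ (Filt-mono (ℕ.m≤m+n _ _) h) (Filt-monomial x y c))
      where
      identity : ∀ f m → f ⊖ m ⊕ m ≋ f
      identity = solve-∀ polySolverRing

    Leading-monomial : ∀ {ε c} x y → ¬ (+ p ∣ c) → Leading ε x y (monomial x (c ℤ.* + (p ^ y)))
    Leading-monomial {c = c} x y p∤c =
      leading c p∤c (Filt-≋ (≋-sym (⊕-inverseʳ (monomial x (c ℤ.* + (p ^ y))))) Filt-[])

    Leading-one : ∀ {ε} → Leading ε 0 0 oneᴾ
    Leading-one = Leading-monomial 0 0 ∤1

    Leading-⊗ : ∀ {ε x x′ y y′ f g} → Leading ε x y f → Leading ε x′ y′ g → Leading ε (x + x′) (y + y′) (f ⊗ g)
    Leading-⊗ {ε} {x} {x′} {y} {y′} {f} {g} (leading c u h) l′@(leading c′ u′ h′) =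
      leading (c ℤ.* c′) (∤-* u u′) (Filt-≋ (≋-trans (identity f g m m′) (⊖-congʳ (f ⊗ g) m⊗m′))
        (Filt-⊕ (Filt-mono (ℕ.≤-reflexive (regroup₁ wd wb x x′ y y′ ε)) (Filt-⊗ h (Leading⇒Filt l′)))
                (Filt-mono (ℕ.≤-reflexive (regroup₂ wd wb x x′ y y′ ε)) (Filt-⊗ (Filt-monomial x y c) h′))))
      where
      m  = monomial x (c ℤ.* + (p ^ y))
      m′ = monomial x′ (c′ ℤ.* + (p ^ y′))
      identity : ∀ f g m m′ → (f ⊖ m) ⊗ g ⊕ m ⊗ (g ⊖ m′) ≋ f ⊗ g ⊖ m ⊗ m′
      identity = solve-∀ polySolverRing
      interchange : ∀ a b e k → a ℤ.* b ℤ.* (e ℤ.* k) ≡ a ℤ.* e ℤ.* (b ℤ.* k)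
      interchange = ℤ-Solver.solve-∀
      m⊗m′ : m ⊗ m′ ≋ monomial (x + x′) (c ℤ.* c′ ℤ.* + (p ^ (y + y′)))
      m⊗m′ = ≋-trans (monomial-⊗ x x′ _ _) (≋-reflexive (cong (monomial (x + x′)) (begin
        c ℤ.* + (p ^ y) ℤ.* (c′ ℤ.* + (p ^ y′))   ≡⟨ interchange c (+ (p ^ y)) c′ (+ (p ^ y′)) ⟩
        c ℤ.* c′ ℤ.* (+ (p ^ y) ℤ.* + (p ^ y′))   ≡⟨ cong (c ℤ.* c′ ℤ.*_) (ℤ.pos-* (p ^ y) (p ^ y′)) ⟨
        c ℤ.* c′ ℤ.* + (p ^ y * p ^ y′)           ≡⟨ cong (λ z → c ℤ.* c′ ℤ.* + z) (ℕ.^-distribˡ-+-* p y y′) ⟨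
        c ℤ.* c′ ℤ.* + (p ^ (y + y′))             ∎)))
        where open ≡-Reasoning
      regroup₁ : ∀ wd wb x x′ y y′ ε →
        wd * (y + y′) + wb * (x + x′) + ε ≡ (wd * y + wb * x + ε) + (wd * y′ + wb * x′)
      regroup₁ = ℕ-Solver.solve-∀
      regroup₂ : ∀ wd wb x x′ y y′ ε →
        wd * (y + y′) + wb * (x + x′) + ε ≡ (wd * y + wb * x) + (wd * y′ + wb * x′ + ε)
      regroup₂ = ℕ-Solver.solve-∀

    Leading-pow : ∀ {ε x y f} n → Leading ε x y f → Leading ε (n * x) (n * y) (powᴾ f n)
    Leading-pow zero    l = Leading-one
    Leading-pow (suc n) l = Leading-⊗ l (Leading-pow n l)

    Leading-neg : ∀ {ε x y f} → Leading ε x y f → Leading ε x y (negᴾ f)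
    Leading-neg {f = f} l = Leading-≋ (identity f) (Leading-⊗ (Leading-monomial 0 0 ∤-1) l)
      where
      ∤-1 : ¬ (+ p ∣ ℤ.- 1ℤ)
      ∤-1 p∣-1 = ∤1 (∣m⇒∣-m p∣-1)
      identity : ∀ f → negᴾ oneᴾ ⊗ f ≋ negᴾ f
      identity = solve-∀ polySolverRing

    Filt⇒≤weight : ∀ {a f i v} → Filt a f → HasVal p (coeff f i) v → a ≤ weight i v
    Filt⇒≤weight {i = i} {v} h val with bound h i
    ... | u , pᵘ∣ , a≤ = ℕ.≤-trans a≤ (ℕ.+-monoˡ-≤ (wb * i) (ℕ.*-monoʳ-≤ wd (hasVal-maximal pᵘ∣ val)))

    coeff-split : ∀ f x m → coeff f x ≡ coeff (monomial x m) x ℤ.+ coeff (f ⊖ monomial x m) x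
    coeff-split f x m = trans (coeffs (identity f (monomial x m)) x) (coeff-⊕ (monomial x m) (f ⊖ monomial x m) x)
      where
      identity : ∀ f m → f ≋ m ⊕ (f ⊖ m)
      identity = solve-∀ polySolverRing

    -- At a fixed degree, more weight can only come from a higher power of p, so a positive gap
    -- makes the remaining part of this coefficient divisible by p^(y+1).
    Leading⇒HasVal : ∀ {ε x y f} → Leading (suc ε) x y f → HasVal p (coeff f x) y
    Leading⇒HasVal {ε} {x} {y} {f} (leading c p∤c h) with bound h x
    ... | v , pᵛ∣ , w<w = hasVal⁺ y p∤c
      (trans (coeff-split f x m) (cong (ℤ._+ coeff (f ⊖ monomial x m) x) (coeff-monomial x m)))
      (∣-trans (^-∣-^ p y<v) pᵛ∣)
      where
      m = c ℤ.* + (p ^ y)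
      y<v : y < v
      y<v = ℕ.*-cancelˡ-< wd y v (ℕ.+-cancelʳ-< (wb * x) _ _ (ℕ.<-≤-trans (ℕ.m<m+n _ ℕ.z<s) w<w))

    -- This is how a leading term is obtained in a new weight: the hypotheses concern only
    -- valuations of coefficients, which do not depend on the weight in which they were found.
    HasVal⇒Leading : ∀ {ε x y f} → HasVal p (coeff f x) y →
      (∀ i → i ≢ x → Σ[ v ∈ ℕ ] (+ (p ^ v) ∣ coeff f i × weight x y + ε ≤ weight i v)) → Leading ε x y f
    HasVal⇒Leading {ε} {x} {y} {f} val others with hasVal⁻ {coeff f x} {y} val
    ... | c , p∤c , fₓ≡ = leading c p∤c (filt bounds)
      where
      m : Poly
      m = monomial x (c ℤ.* + (p ^ y))
      coeff-⊖ : ∀ i → coeff (f ⊖ m) i ≡ coeff f i ℤ.- coeff m i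
      coeff-⊖ i = trans (coeff-⊕ f (negᴾ m) i) (cong (λ z → coeff f i ℤ.+ z) (coeff-neg m i))
      bounds : ∀ i → Σ[ v ∈ ℕ ] (+ (p ^ v) ∣ coeff (f ⊖ m) i × weight x y + ε ≤ weight i v)
      bounds i with i ℕ.≟ x
      ... | yes refl = subst (λ z → Σ[ v ∈ ℕ ] (+ (p ^ v) ∣ z × weight x y + ε ≤ weight x v))
        (sym (trans (coeff-⊖ x) (ℤ.i≡j⇒i-j≡0 {coeff f x} {coeff m x} (trans fₓ≡ (sym (coeff-monomial x _))))))
        (∣0-bound (weight x y + ε) x)
      ... | no i≢x = subst (λ z → Σ[ v ∈ ℕ ] (+ (p ^ v) ∣ z × weight x y + ε ≤ weight i v))
        (sym (trans (coeff-⊖ i) (trans (cong (λ z → coeff f i ℤ.- z) (coeff-monomial-≢ x i _ i≢x)) (ℤ.+-identityʳ (coeff f i)))))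
        (others i i≢x)

    Leading-bound : ∀ {ε x y f} → Leading ε x y f →
      ∀ i → i ≢ x → Σ[ v ∈ ℕ ] (+ (p ^ v) ∣ coeff f i × weight x y + ε ≤ weight i v)
    Leading-bound {x = x} {y} {f} (leading c _ h) i i≢x with bound h i
    ... | v , pᵛ∣ , w≤ = v , subst (+ (p ^ v) ∣_) (sym coeff≡) pᵛ∣ , w≤
      where
      m : Poly
      m = monomial x (c ℤ.* + (p ^ y))
      identity : ∀ f m → f ≋ m ⊕ (f ⊖ m)
      identity = solve-∀ polySolverRing
      coeff≡ : coeff f i ≡ coeff (f ⊖ m) i
      coeff≡ = begin
        coeff f i                            ≡⟨ coeffs (identity f m) i ⟩
        coeff (m ⊕ (f ⊖ m)) i                ≡⟨ coeff-⊕ m (f ⊖ m) i ⟩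
        coeff m i ℤ.+ coeff (f ⊖ m) i        ≡⟨ cong (ℤ._+ coeff (f ⊖ m) i) (coeff-monomial-≢ x i _ i≢x) ⟩
        0ℤ ℤ.+ coeff (f ⊖ m) i               ≡⟨ ℤ.+-identityˡ _ ⟩
        coeff (f ⊖ m) i                      ∎
        where open ≡-Reasoning

    Leading-bd : ∀ {ε} → Leading ε 1 1 (bd p)
    Leading-bd = Leading-≋ (≋-sym (≋-trans (monomial-⊗ 0 1 (+ p) 1ℤ) (≋-reflexive (cong (monomial 1) (begin
      + p ℤ.* 1ℤ         ≡⟨ ℤ.*-comm (+ p) 1ℤ ⟩
      1ℤ ℤ.* + p         ≡⟨ cong (λ z → 1ℤ ℤ.* + z) (ℕ.^-identityʳ p) ⟨
      1ℤ ℤ.* + (p ^ 1)   ∎))))) (Leading-monomial 1 1 ∤1)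
      where open ≡-Reasoning

-- Divisibility of binomial coefficients by a prime.

absorption : ∀ n j → suc j * (suc n C suc j) ≡ suc n * (n C j)
absorption zero    zero    = refl
absorption zero    (suc j) = begin
  suc (suc j) * (1 C suc (suc j))   ≡⟨ cong (suc (suc j) *_) (k>n⇒nCk≡0 {1} {suc (suc j)} (s≤s (s≤s z≤n))) ⟩
  suc (suc j) * 0                   ≡⟨ ℕ.*-zeroʳ (suc (suc j)) ⟩
  1 * 0                             ≡⟨ cong (1 *_) (k>n⇒nCk≡0 {0} {suc j} (s≤s z≤n)) ⟨
  1 * (0 C suc j)                   ∎
  where open ≡-Reasoning
absorption (suc n) zero    = begin
  1 * (suc (suc n) C 1)   ≡⟨ cong (1 *_) (nC1≡n (suc (suc n))) ⟩
  1 * suc (suc n)         ≡⟨ ℕ.*-comm 1 (suc (suc n)) ⟩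
  suc (suc n) * 1         ∎
  where open ≡-Reasoning
absorption (suc n) (suc j) = begin
  suc (suc j) * (suc (suc n) C suc (suc j))
    ≡⟨ cong (suc (suc j) *_) (nCk+nC[k+1]≡[n+1]C[k+1] (suc n) (suc j)) ⟨
  suc (suc j) * ((suc n C suc j) + (suc n C suc (suc j)))
    ≡⟨ split j (suc n C suc j) (suc n C suc (suc j)) ⟩
  (suc n C suc j) + suc j * (suc n C suc j) + suc (suc j) * (suc n C suc (suc j))
    ≡⟨ cong₂ (λ a b → (suc n C suc j) + a + b) (absorption n j) (absorption n (suc j)) ⟩
  (suc n C suc j) + suc n * (n C j) + suc n * (n C suc j)
    ≡⟨ regroup n (suc n C suc j) (n C j) (n C suc j) ⟩
  (suc n C suc j) + suc n * ((n C j) + (n C suc j))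
    ≡⟨ cong (λ a → (suc n C suc j) + suc n * a) (nCk+nC[k+1]≡[n+1]C[k+1] n j) ⟩
  suc (suc n) * (suc n C suc j) ∎
  where
  open ≡-Reasoning
  split : ∀ j a b → (2 + j) * (a + b) ≡ a + (1 + j) * a + (2 + j) * b
  split = ℕ-Solver.solve-∀
  regroup : ∀ n a b c → a + (1 + n) * b + (1 + n) * c ≡ a + (1 + n) * (b + c)
  regroup = ℕ-Solver.solve-∀

-- By `absorption` the prime divides (j+1) times the binomial coefficient, and 0 < j+1 < n+1
-- excludes the first factor.
prime-∣-C : ∀ {n} j → Prime (suc n) → j < n → suc n ℕ∣.∣ (suc n C suc j)
prime-∣-C {n} j pr j<n with euclidsLemma (suc j) (suc n C suc j) pr
    (subst (suc n ℕ∣.∣_) (sym (absorption n j)) (ℕ∣.m∣m*n (n C j)))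
... | inj₁ p∣j+1 = ⊥-elim (ℕ.<⇒≱ (s≤s j<n) (ℕ∣.∣⇒≤ p∣j+1))
... | inj₂ p∣C   = p∣C

coeff₀-⊕ : ∀ p q → coeff (p ⊕ q) 0 ≡ coeff p 0 ℤ.+ coeff q 0
coeff₀-⊕ p q = coeff-⊕ p q 0

coeff₀-⊗ : ∀ p q → coeff (p ⊗ q) 0 ≡ coeff p 0 ℤ.* coeff q 0
coeff₀-⊗ []      q = refl
coeff₀-⊗ (a ∷ p) q = trans (coeff-⊕ (scale a q) (0ℤ ∷ (p ⊗ q)) 0)
  (trans (ℤ.+-identityʳ _) (coeff-scale a q 0))

coeff₀-pow : ∀ p n → coeff (powᴾ p n) 0 ≡ coeff p 0 ℤ.^ n
coeff₀-pow p zero    = refl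
coeff₀-pow p (suc n) = trans (coeff₀-⊗ p (powᴾ p n)) (cong (coeff p 0 ℤ.*_) (coeff₀-pow p n))

-- Weight and content estimates for σ, τ, θ and 𝒢.

module Estimates (k : ℕ) (prime : Prime (suc (suc k))) where

  open Dynamics k
  open Valuation prime

  -- width n is the horizontal length d^(n+1) - d^n - 1 of the principal polygon of 𝒢_{n+1}.
  e width : ℕ → ℕ
  e zero    = 0
  e (suc n) = width n + suc (e n)
  width n = e n + k * suc (e n)

  -- `e n` stands for d^n - 1. Defining it together with `width` without subtraction lets the
  -- semiring solver handle all exponents.
  d^≡ : ∀ n → d ^ n ≡ suc (e n)
  d^≡ zero    = refl
  d^≡ (suc n) = trans (cong (d *_) (d^≡ n)) (identity k (e n))
    where
    identity : ∀ k e → (2 + k) * (1 + e) ≡ 1 + (e + k * (1 + e) + (1 + e))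
    identity = ℕ-Solver.solve-∀

  d^1∣d : + (d ^ 1) ∣ + d
  d^1∣d = divides 1ℤ (trans (cong +_ (sym (ℕ.^-identityʳ d))) (sym (ℤ.*-identityˡ _)))

  module Base where

    open Weighted (suc k) 1 public

    mutual
      s-filt : ∀ n → Filt (e n) (sₙ n)
      s-filt zero    = Filt-zero oneᴾ
      s-filt (suc n) = Filt-≋ (≋-sym (s≋σ⊕τ n)) (Filt-⊕ (σ-filt n) (τ-filt n))

      -- With M = d^n this is (d-1) + d(M-1) = dM - 1: giving d the weight d - 1 is what reproduces
      -- the bound at the next index.
      σ-filt : ∀ n → Filt (e (suc n)) (σₙ n)
      σ-filt n = Filt-mono (ℕ.≤-reflexive (identity k (e n)))
        (Filt-⊗ (Filt-⊗ (Filt-zero b+1) (Filt-const 1 d^1∣d (ℕ.≤-reflexive (sym (ℕ.*-identityʳ (suc k)))))) (Filt-pow d (s-filt n)))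
        where
        identity : ∀ k e → e + k * (1 + e) + (1 + e) ≡ 0 + (1 + k) + (2 + k) * e
        identity = ℕ-Solver.solve-∀

      τ-filt : ∀ n → Filt (e (suc n)) (τₙ n)
      τ-filt n = Filt-mono (ℕ.<⇒≤ (ℕ.≤-reflexive (identity k (e n)))) (Leading⇒Filt (τ-leading n))
        where
        identity : ∀ k e → 1 + (e + k * (1 + e) + (1 + e)) ≡ (1 + k) * (1 + e) + 1 * (1 + e)
        identity = ℕ-Solver.solve-∀

      τ-leading : ∀ n → Leading 1 (suc (e n)) (suc (e n)) (τₙ n)
      τ-leading n = Leading-≋ (≋-sym (τ≋bdθ n)) (Leading-⊗ Leading-bd (θ-leading n))

      -- Only the power τ^(d-2) has a coefficient prime to d. In the other terms up to d - 2 factors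
      -- σ may each be lighter than τ by 1, but d divides the binomial coefficient and adds d - 1,
      -- which leaves a gap of 1.
      remainder-leading : ∀ n → Leading 1 (k * suc (e n)) (k * suc (e n)) (remainder n)
      remainder-leading n = Leading-≋ (identity (powᴾ (τₙ n) k) (remainder n))
        (Leading-perturb (Leading-pow k (τ-leading n))
          (Filt-mono (ℕ.≤-reflexive (identity′ k (e n)))
            (Filt-homSum-⊖ k (λ j → + (d C suc (suc j)))
              (λ j j<k → ∣ᵤ⇒∣ (prime-∣-C (suc j) prime (s≤s j<k)))
              (cong +_ (nCn≡1 d)) (σ-filt n) (τ-filt n))))
        where
        identity : ∀ f g → f ⊕ (g ⊖ f) ≋ g
        identity = solve-∀ polySolverRing
        identity′ : ∀ k e → (1 + k) * (k * (1 + e)) + 1 * (k * (1 + e)) + 1 ≡ (1 + k) + k * (e + k * (1 + e) + (1 + e))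
        identity′ = ℕ-Solver.solve-∀

      -- The leading monomial is that of -θR, with R the remainder. The bound (d-1)(dM-1) for the σ
      -- term exceeds its weight d((d-1)M-1) by exactly 1, and the extra factor bd adds d.
      G-leading : ∀ n → Leading 1 (width n) (width n) (G n)
      G-leading n = Leading-≋ (identity (powᴾ (σₙ n) (suc k)) c-d-1 (bd d) (θ n ⊗ remainder n))
        (Leading-perturb (Leading-neg θR-leading)
          (Filt-neg (Filt-⊕
            (Filt-mono (ℕ.≤-reflexive (identity′ k (e n))) (Filt-⊗ (Filt-zero c-d-1) (Filt-pow (suc k) (σ-filt n))))
            (Filt-mono (ℕ.≤-trans (ℕ.≤-reflexive (ℕ.+-comm w 1)) (ℕ.+-monoˡ-≤ w {1} {weight 1 1} (s≤s z≤n)))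
              (Filt-⊗ (Leading⇒Filt (Leading-bd {ε = 1})) (Leading⇒Filt θR-leading))))))
        where
        w = weight (width n) (width n)
        θR-leading : Leading 1 (width n) (width n) (θ n ⊗ remainder n)
        θR-leading = Leading-⊗ (θ-leading n) (remainder-leading n)
        identity : ∀ s c x t → negᴾ t ⊕ negᴾ (c ⊗ s ⊕ x ⊗ t) ≋ negᴾ (c ⊗ s) ⊖ (x ⊕ oneᴾ) ⊗ t
        identity = solve-∀ polySolverRing
        identity′ : ∀ k e → (1 + k) * (e + k * (1 + e)) + 1 * (e + k * (1 + e)) + 1 ≡
          0 + (1 + k) * (e + k * (1 + e) + (1 + e))
        identity′ = ℕ-Solver.solve-∀

      θ-leading : ∀ n → Leading 1 (e n) (e n) (θ n)
      θ-leading zero    = Leading-neg Leading-one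
      θ-leading (suc n) = subst (λ z → Leading 1 z z (θ (suc n))) (sym (ℕ.+-suc (width n) (e n)))
        (Leading-⊗ Leading-bd (Leading-⊗ (G-leading n) (θ-leading n)))

  -- With weights 1 and 0, Filt a is the ideal generated by d^a.
  module Content where

    open Weighted 1 0 public

    bd-filt : Filt 1 (bd d)
    bd-filt = Leading⇒Filt (Leading-bd {ε = 0})

    mutual
      s-filt : ∀ n → Filt (suc (e n)) (sₙ (suc n))
      s-filt n = Filt-≋ (≋-sym (s≋σ⊕τ n)) (Filt-⊕ (σ-filt n) (τ-filt n))

      σ-filt : ∀ n → Filt (suc (e n)) (σₙ n)
      σ-filt n = Filt-mono (level n) (Filt-⊗ (Filt-⊗ (Filt-zero b+1) (Filt-const 1 d^1∣d ℕ.≤-refl)) (power n))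
        where
        -- s_0 = 1 has no factor d, hence the case distinction. At n = 0 the explicit factor d of σ
        -- is just enough; later it is one more than required.
        l : ℕ → ℕ
        l zero    = 0
        l (suc n) = d * suc (e n)
        power : ∀ n → Filt (l n) (powᴾ (sₙ n) d)
        power zero    = Filt-zero _
        power (suc n) = Filt-pow d (s-filt n)
        level : ∀ n → suc (e n) ≤ 0 + 1 + l n
        level zero    = ℕ.≤-refl
        level (suc n) = ℕ.≤-trans (ℕ.≤-reflexive (identity k (e n))) (ℕ.n≤1+n _)
          where
          identity : ∀ k e → 1 + (e + k * (1 + e) + (1 + e)) ≡ (2 + k) * (1 + e)
          identity = ℕ-Solver.solve-∀

      τ-filt : ∀ n → Filt (suc (e n)) (τₙ n)
      τ-filt n = Filt-≋ (≋-sym (τ≋bdθ n)) (Filt-⊗ bd-filt (θ-filt n))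

      G-filt : ∀ n → Filt (width n) (G n)
      G-filt n = Filt-⊖
        (Filt-neg (Filt-mono (ℕ.≤-trans (ℕ.n≤1+n (width n)) (ℕ.≤-reflexive (identity k (e n))))
          (Filt-⊗ (Filt-zero c-d-1) (Filt-pow (suc k) (σ-filt n)))))
        (Filt-⊗ (Filt-zero (bd+1 d)) (Filt-⊗ (θ-filt n) (Filt-homSum k _ (σ-filt n) (τ-filt n))))
        where
        identity : ∀ k e → 1 + (e + k * (1 + e)) ≡ 0 + (1 + k) * (1 + e)
        identity = ℕ-Solver.solve-∀

      θ-filt : ∀ n → Filt (e n) (θ n)
      θ-filt zero    = Filt-zero _
      θ-filt (suc n) = Filt-mono (ℕ.≤-reflexive (ℕ.+-suc (width n) (e n)))
        (Filt-⊗ bd-filt (Filt-⊗ (G-filt n) (θ-filt n)))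

-- The constant coefficient of 𝒢.

pos-^ : ∀ a n → (+ a) ℤ.^ n ≡ + (a ^ n)
pos-^ a zero    = refl
pos-^ a (suc n) = trans (cong (+ a ℤ.*_) (pos-^ a n)) (sym (ℤ.pos-* a (a ^ n)))

coeff₀-homSum : ∀ p q n c → coeff q 0 ≡ 0ℤ → coeff (homSum p q n c) 0 ≡ c 0 ℤ.* coeff p 0 ℤ.^ n
coeff₀-homSum p q zero    c q₀≡0 = sym (ℤ.*-identityʳ (c 0))
coeff₀-homSum p q (suc n) c q₀≡0 = begin
  coeff (const (c 0) ⊗ powᴾ p (suc n) ⊕ q ⊗ h) 0
    ≡⟨ coeff₀-⊕ (const (c 0) ⊗ powᴾ p (suc n)) (q ⊗ h) ⟩
  coeff (const (c 0) ⊗ powᴾ p (suc n)) 0 ℤ.+ coeff (q ⊗ h) 0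
    ≡⟨ cong₂ ℤ._+_ (coeff₀-⊗ (const (c 0)) (powᴾ p (suc n))) (trans (coeff₀-⊗ q h) (cong (ℤ._* coeff h 0) q₀≡0)) ⟩
  c 0 ℤ.* coeff (powᴾ p (suc n)) 0 ℤ.+ 0ℤ
    ≡⟨ ℤ.+-identityʳ _ ⟩
  c 0 ℤ.* coeff (powᴾ p (suc n)) 0
    ≡⟨ cong (c 0 ℤ.*_) (coeff₀-pow p (suc n)) ⟩
  c 0 ℤ.* coeff p 0 ℤ.^ suc n ∎
  where
  open ≡-Reasoning
  h = homSum p q n (c ∘ suc)

module ConstantCoefficient (k : ℕ) (prime : Prime (suc (suc k))) (1≤k : 1 ≤ k) where

  open Dynamics k
  open Valuation prime
  open Estimates k prime

  [d-1]D≡e : ∀ n → suc k * D d n ≡ e n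
  [d-1]D≡e zero    = ℕ.*-zeroʳ (suc k)
  [d-1]D≡e (suc n) = begin
    suc k * (1 + d * D d n)     ≡⟨ expand k (D d n) ⟩
    suc k + d * (suc k * D d n) ≡⟨ cong (λ z → suc k + d * z) ([d-1]D≡e n) ⟩
    suc k + d * e n             ≡⟨ collect k (e n) ⟩
    e (suc n)                   ∎
    where
    open ≡-Reasoning
    expand : ∀ k D → (1 + k) * (1 + (2 + k) * D) ≡ 1 + k + (2 + k) * ((1 + k) * D)
    expand = ℕ-Solver.solve-∀
    collect : ∀ k e → 1 + k + (2 + k) * e ≡ e + k * (1 + e) + (1 + e)
    collect = ℕ-Solver.solve-∀

  d*^d : ∀ n → + d ℤ.* (+ (d ^ D d n)) ℤ.^ d ≡ + (d ^ D d (suc n))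
  d*^d n = begin
    + d ℤ.* (+ (d ^ D d n)) ℤ.^ d   ≡⟨ cong (+ d ℤ.*_) (pos-^ (d ^ D d n) d) ⟩
    + d ℤ.* + ((d ^ D d n) ^ d)     ≡⟨ ℤ.pos-* d ((d ^ D d n) ^ d) ⟨
    + (d * (d ^ D d n) ^ d)         ≡⟨ cong (λ z → + (d * z)) (trans (ℕ.^-*-assoc d (D d n) d) (cong (d ^_) (ℕ.*-comm (D d n) d))) ⟩
    + (d ^ D d (suc n))             ∎
    where open ≡-Reasoning

  -- At b = 0 both recursions become a ↦ d a^d as long as r and s agree, and the exponent of d then
  -- follows the recursion of `D`.
  coeff₀-rs : ∀ n → coeff (rₙ n) 0 ≡ + (d ^ D d n) × coeff (sₙ n) 0 ≡ + (d ^ D d n)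
  coeff₀-rs zero    = refl , refl
  coeff₀-rs (suc n) with coeff₀-rs n
  ... | r₀ , s₀ = r₀′ , s₀′
    where
    open ≡-Reasoning
    a = + (d ^ D d n)
    r₀′ : coeff (rₙ (suc n)) 0 ≡ + (d ^ D d (suc n))
    r₀′ = begin
      coeff (b+1 ⊗ c-d ⊗ rₙ n ⊗ powᴾ (sₙ n) (suc k)) 0
        ≡⟨ coeff₀-⊗ (b+1 ⊗ c-d ⊗ rₙ n) (powᴾ (sₙ n) (suc k)) ⟩
      coeff (b+1 ⊗ c-d ⊗ rₙ n) 0 ℤ.* coeff (powᴾ (sₙ n) (suc k)) 0
        ≡⟨ cong₂ ℤ._*_ (trans (coeff₀-⊗ (b+1 ⊗ c-d) (rₙ n)) (cong₂ ℤ._*_ (coeff₀-⊗ b+1 c-d) r₀))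
                       (trans (coeff₀-pow (sₙ n) (suc k)) (cong (ℤ._^ suc k) s₀)) ⟩
      1ℤ ℤ.* + d ℤ.* a ℤ.* a ℤ.^ suc k   ≡⟨ regroup (+ d) a (a ℤ.^ suc k) ⟩
      + d ℤ.* a ℤ.^ d                    ≡⟨ d*^d n ⟩
      + (d ^ D d (suc n))                ∎
      where
      regroup : ∀ c a b → 1ℤ ℤ.* c ℤ.* a ℤ.* b ≡ c ℤ.* (a ℤ.* b)
      regroup = ℤ-Solver.solve-∀
    s₀′ : coeff (sₙ (suc n)) 0 ≡ + (d ^ D d (suc n))
    s₀′ = begin
      coeff (powᴾ (rₙ n) d ⊕ c-d-1 ⊗ powᴾ (sₙ n) d) 0
        ≡⟨ coeff₀-⊕ (powᴾ (rₙ n) d) (c-d-1 ⊗ powᴾ (sₙ n) d) ⟩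
      coeff (powᴾ (rₙ n) d) 0 ℤ.+ coeff (c-d-1 ⊗ powᴾ (sₙ n) d) 0
        ≡⟨ cong₂ ℤ._+_ (trans (coeff₀-pow (rₙ n) d) (cong (ℤ._^ d) r₀))
             (trans (coeff₀-⊗ c-d-1 (powᴾ (sₙ n) d)) (cong (+ suc k ℤ.*_) (trans (coeff₀-pow (sₙ n) d) (cong (ℤ._^ d) s₀)))) ⟩
      a ℤ.^ d ℤ.+ + suc k ℤ.* a ℤ.^ d    ≡⟨ regroup (+ suc k) (a ℤ.^ d) ⟩
      (1ℤ ℤ.+ + suc k) ℤ.* a ℤ.^ d       ≡⟨ d*^d n ⟩
      + (d ^ D d (suc n))                ∎
      where
      regroup : ∀ c b → b ℤ.+ c ℤ.* b ≡ (1ℤ ℤ.+ c) ℤ.* b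
      regroup = ℤ-Solver.solve-∀

  coeff₀-σ : ∀ n → coeff (σₙ n) 0 ≡ + (d ^ D d (suc n))
  coeff₀-σ n = begin
    coeff (b+1 ⊗ c-d ⊗ powᴾ (sₙ n) d) 0          ≡⟨ coeff₀-⊗ (b+1 ⊗ c-d) (powᴾ (sₙ n) d) ⟩
    coeff (b+1 ⊗ c-d) 0 ℤ.* coeff (powᴾ (sₙ n) d) 0
      ≡⟨ cong₂ ℤ._*_ (trans (coeff₀-⊗ b+1 c-d) (ℤ.*-identityˡ (+ d))) (trans (coeff₀-pow (sₙ n) d) (cong (ℤ._^ d) (proj₂ (coeff₀-rs n)))) ⟩
    + d ℤ.* (+ (d ^ D d n)) ℤ.^ d                ≡⟨ d*^d n ⟩
    + (d ^ D d (suc n))                          ∎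
    where open ≡-Reasoning

  coeff₀-σ^[d-1] : ∀ n → coeff (powᴾ (σₙ n) (suc k)) 0 ≡ + (d ^ e (suc n))
  coeff₀-σ^[d-1] n = begin
    coeff (powᴾ (σₙ n) (suc k)) 0      ≡⟨ trans (coeff₀-pow (σₙ n) (suc k)) (cong (ℤ._^ suc k) (coeff₀-σ n)) ⟩
    (+ (d ^ D d (suc n))) ℤ.^ suc k    ≡⟨ pos-^ (d ^ D d (suc n)) (suc k) ⟩
    + ((d ^ D d (suc n)) ^ suc k)      ≡⟨ cong +_ (ℕ.^-*-assoc d (D d (suc n)) (suc k)) ⟩
    + (d ^ (D d (suc n) * suc k))      ≡⟨ cong (λ z → + (d ^ z)) (trans (ℕ.*-comm (D d (suc n)) (suc k)) ([d-1]D≡e (suc n))) ⟩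
    + (d ^ e (suc n))                  ∎
    where open ≡-Reasoning

  coeff₀-bd⊗ : ∀ f → coeff (bd d ⊗ f) 0 ≡ 0ℤ
  coeff₀-bd⊗ f = trans (coeff₀-⊗ (bd d) f)
    (cong (ℤ._* coeff f 0) (trans (coeff₀-⊗ c-d X) (ℤ.*-zeroʳ (+ d))))

  coeff₀-bd+1⊗ : ∀ f → coeff (bd+1 d ⊗ f) 0 ≡ coeff f 0
  coeff₀-bd+1⊗ f = begin
    coeff (bd+1 d ⊗ f) 0                    ≡⟨ coeff₀-⊗ (bd+1 d) f ⟩
    coeff (bd+1 d) 0 ℤ.* coeff f 0
      ≡⟨ cong (ℤ._* coeff f 0) (trans (coeff₀-⊕ (bd d) oneᴾ) (cong (ℤ._+ 1ℤ) (trans (coeff₀-⊗ c-d X) (ℤ.*-zeroʳ (+ d))))) ⟩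
    1ℤ ℤ.* coeff f 0                        ≡⟨ ℤ.*-identityˡ _ ⟩
    coeff f 0                               ∎
    where open ≡-Reasoning

  coeff₀-G : ∀ n → coeff (G n) 0 ≡
    ℤ.- (+ suc k ℤ.* + (d ^ e (suc n))) ℤ.+ ℤ.- (coeff (θ n) 0 ℤ.* coeff (remainder n) 0)
  coeff₀-G n = begin
    coeff (negᴾ f ⊖ bd+1 d ⊗ g) 0                         ≡⟨ coeff₀-⊕ (negᴾ f) (negᴾ (bd+1 d ⊗ g)) ⟩
    coeff (negᴾ f) 0 ℤ.+ coeff (negᴾ (bd+1 d ⊗ g)) 0      ≡⟨ cong₂ ℤ._+_ (coeff-neg f 0) (coeff-neg (bd+1 d ⊗ g) 0) ⟩
    ℤ.- coeff f 0 ℤ.+ ℤ.- coeff (bd+1 d ⊗ g) 0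
      ≡⟨ cong₂ (λ a b → ℤ.- a ℤ.+ ℤ.- b)
           (trans (coeff₀-⊗ c-d-1 (powᴾ (σₙ n) (suc k))) (cong (+ suc k ℤ.*_) (coeff₀-σ^[d-1] n)))
           (trans (coeff₀-bd+1⊗ g) (coeff₀-⊗ (θ n) (remainder n))) ⟩
    ℤ.- (+ suc k ℤ.* + (d ^ e (suc n))) ℤ.+ ℤ.- (coeff (θ n) 0 ℤ.* coeff (remainder n) 0) ∎
    where
    open ≡-Reasoning
    f = c-d-1 ⊗ powᴾ (σₙ n) (suc k)
    g = θ n ⊗ remainder n

  d∤d-1 : ¬ (+ d ∣ + suc k)
  d∤d-1 d∣ = ℕ.<⇒≱ (ℕ.n<1+n (suc k)) (ℕ∣.∣⇒≤ (∣⇒∣ᵤ d∣))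

  G₀-hasVal : ∀ n → HasVal d (coeff (G n) 0) (e (suc n))
  -- `θ (suc n)` has the factor b, so only -(d-1) σ^(d-1) survives at b = 0.
  G₀-hasVal (suc n) = hasVal⁺ {c = ℤ.- (+ suc k)} (e (suc (suc n))) d∤ coeff≡ (∣0 _)
    where
    d∤ : ¬ (+ d ∣ ℤ.- (+ suc k))
    d∤ d∣ = d∤d-1 (∣m⇒∣-m d∣)
    identity : ∀ a b c → ℤ.- (a ℤ.* b) ℤ.+ ℤ.- (0ℤ ℤ.* c) ≡ ℤ.- a ℤ.* b ℤ.+ 0ℤ
    identity = ℤ-Solver.solve-∀
    coeff≡ : coeff (G (suc n)) 0 ≡ ℤ.- (+ suc k) ℤ.* + (d ^ e (suc (suc n))) ℤ.+ 0ℤ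
    coeff≡ = trans (coeff₀-G (suc n)) (trans
      (cong (λ z → ℤ.- (+ suc k ℤ.* + (d ^ e (suc (suc n)))) ℤ.+ ℤ.- (z ℤ.* coeff (remainder (suc n)) 0)) (coeff₀-bd⊗ (G n ⊗ θ n)))
      (identity (+ suc k) (+ (d ^ e (suc (suc n)))) (coeff (remainder (suc n)) 0)))
  -- Here θ_0 = -1 contributes C(d,2) d^(d-2) = ((d-1)/2) d^(d-1).
  G₀-hasVal zero with prime-∣-C 1 prime (s≤s 1≤k)
  ... | ℕ∣.divides q C≡ = hasVal⁺ {c = + q ℤ.- + suc k} (e 1) d∤ coeff≡ (∣0 _)
    where
    open ≡-Reasoning
    2q≡d-1 : 2 * q ≡ suc k
    2q≡d-1 = ℕ.*-cancelʳ-≡ (2 * q) (suc k) d (begin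
      2 * q * d             ≡⟨ ℕ.*-assoc 2 q d ⟩
      2 * (q * d)           ≡⟨ cong (2 *_) C≡ ⟨
      2 * (d C 2)           ≡⟨ absorption (suc k) 1 ⟩
      d * (suc k C 1)       ≡⟨ cong (d *_) (nC1≡n (suc k)) ⟩
      d * suc k             ≡⟨ ℕ.*-comm d (suc k) ⟩
      suc k * d             ∎)
    d∤ : ¬ (+ d ∣ + q ℤ.- + suc k)
    d∤ d∣ = d∤d-1 (subst (+ d ∣_) (begin
      ℤ.- (+ 2 ℤ.* (+ q ℤ.- + suc k))               ≡⟨ double (+ q) (+ suc k) ⟩
      + 2 ℤ.* + suc k ℤ.- + 2 ℤ.* + q               ≡⟨ cong (λ z → + 2 ℤ.* + suc k ℤ.- z) (trans (sym (ℤ.pos-* 2 q)) (cong +_ 2q≡d-1)) ⟩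
      + 2 ℤ.* + suc k ℤ.- + suc k                   ≡⟨ halve (+ suc k) ⟩
      + suc k                                       ∎) (∣m⇒∣-m (∣n⇒∣m*n (+ 2) d∣)))
      where
      double : ∀ a b → ℤ.- (+ 2 ℤ.* (a ℤ.- b)) ≡ + 2 ℤ.* b ℤ.- + 2 ℤ.* a
      double = ℤ-Solver.solve-∀
      halve : ∀ a → + 2 ℤ.* a ℤ.- a ≡ a
      halve = ℤ-Solver.solve-∀
    e₁≡ : e 1 ≡ suc k
    e₁≡ = identity k
      where
      identity : ∀ k → 0 + k * 1 + 1 ≡ 1 + k
      identity = ℕ-Solver.solve-∀
    R₀ : coeff (remainder 0) 0 ≡ + q ℤ.* + (d ^ e 1)
    R₀ = begin
      coeff (remainder 0) 0                      ≡⟨ coeff₀-homSum (σₙ 0) (τₙ 0) k (λ j → + (d C suc (suc j))) (trans (coeffs (τ≋bdθ 0) 0) (coeff₀-bd⊗ (θ 0))) ⟩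
      + (d C 2) ℤ.* coeff (σₙ 0) 0 ℤ.^ k         ≡⟨ cong₂ (λ a b → + a ℤ.* b ℤ.^ k) C≡ (trans (coeff₀-σ 0) (cong (λ z → + (d ^ suc z)) (ℕ.*-zeroʳ d))) ⟩
      + (q * d) ℤ.* (+ (d ^ 1)) ℤ.^ k            ≡⟨ cong₂ ℤ._*_ (ℤ.pos-* q d) (trans (cong (λ z → (+ z) ℤ.^ k) (ℕ.^-identityʳ d)) (pos-^ d k)) ⟩
      + q ℤ.* + d ℤ.* + (d ^ k)                  ≡⟨ ℤ.*-assoc (+ q) (+ d) (+ (d ^ k)) ⟩
      + q ℤ.* (+ d ℤ.* + (d ^ k))                ≡⟨ cong (+ q ℤ.*_) (ℤ.pos-* d (d ^ k)) ⟨
      + q ℤ.* + (d ^ suc k)                      ≡⟨ cong (λ z → + q ℤ.* + (d ^ z)) e₁≡ ⟨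
      + q ℤ.* + (d ^ e 1)                        ∎
    identity : ∀ a b c → ℤ.- (a ℤ.* b) ℤ.+ ℤ.- (ℤ.- 1ℤ ℤ.* (c ℤ.* b)) ≡ (c ℤ.- a) ℤ.* b ℤ.+ 0ℤ
    identity = ℤ-Solver.solve-∀
    coeff≡ : coeff (G 0) 0 ≡ (+ q ℤ.- + suc k) ℤ.* + (d ^ e 1) ℤ.+ 0ℤ
    coeff≡ = trans (coeff₀-G 0) (trans
      (cong (λ z → ℤ.- (+ suc k ℤ.* + (d ^ e 1)) ℤ.+ ℤ.- (ℤ.- 1ℤ ℤ.* z)) R₀)
      (identity (+ suc k) (+ (d ^ e 1)) (+ q)))

-- Polygon edges as level lines of linear forms.

pos-weight : ∀ a b c e → + (a * b + c * e) ≡ + a ℤ.* + b ℤ.+ + c ℤ.* + e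
pos-weight a b c e = trans (ℤ.pos-+ (a * b) (c * e)) (cong₂ ℤ._+_ (ℤ.pos-* a b) (ℤ.pos-* c e))

-- The edge is a level line of the form w v + h i, and the hypothesis says that no point takes a
-- smaller value. Adding the same integer `c i` to both sides turns this into the cross-multiplied
-- inequality.
lowerEdge : ∀ p f x y w h → 0 < w → 0 < h →
  (∀ i v → HasVal p (coeff f i) v → w * (y + h) + h * x ≤ w * v + h * i) →
  LowerEdge p f ((x , y + h) , (x + w , y))
lowerEdge p f x y w h 0<w 0<h above = ℕ.m<m+n x 0<w , ℕ.m<m+n y 0<h , λ i v val →
  subst₂ ℤ._≤_
    (trans (cong (ℤ._+ c i) (trans (pos-weight w (y + h) h x) (cong (λ z → + w ℤ.* z ℤ.+ + h ℤ.* + x) (ℤ.pos-+ y h))))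
      (trans (left (+ w) (+ h) (+ x) (+ y) (+ i)) (cong (λ z → (+ y ℤ.- z) ℤ.* (+ i ℤ.- + x)) (sym (ℤ.pos-+ y h)))))
    (trans (cong (ℤ._+ c i) (pos-weight w v h i))
      (trans (right (+ w) (+ h) (+ x) (+ y) (+ i) (+ v))
        (cong₂ (λ z z′ → (+ v ℤ.- z) ℤ.* (z′ ℤ.- + x)) (sym (ℤ.pos-+ y h)) (sym (ℤ.pos-+ x w)))))
    (ℤ.+-monoˡ-≤ (c i) (ℤ.+≤+ (above i v val)))
  where
  c : ℕ → ℤ
  c i = ℤ.- (+ w ℤ.* (+ y ℤ.+ + h) ℤ.+ + h ℤ.* + i)
  left : ∀ w h x y i → w ℤ.* (y ℤ.+ h) ℤ.+ h ℤ.* x ℤ.+ ℤ.- (w ℤ.* (y ℤ.+ h) ℤ.+ h ℤ.* i) ≡ (y ℤ.- (y ℤ.+ h)) ℤ.* (i ℤ.- x)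
  left = ℤ-Solver.solve-∀
  right : ∀ w h x y i v → w ℤ.* v ℤ.+ h ℤ.* i ℤ.+ ℤ.- (w ℤ.* (y ℤ.+ h) ℤ.+ h ℤ.* i) ≡ (v ℤ.- (y ℤ.+ h)) ℤ.* ((x ℤ.+ w) ℤ.- x)
  right = ℤ-Solver.solve-∀

slopeIncr : ∀ x y w w′ h h′ → h′ * w < h * w′ →
  SlopeIncr ((x , y + h′ + h) , (x + w , y + h′) , (x + w + w′ , y))
slopeIncr x y w w′ h h′ h′w<hw′ = subst₂ ℤ._<_
  (trans (cong ℤ.-_ (ℤ.pos-* h w′)) (trans (left (+ h) (+ w′) (+ x ℤ.+ + w) (+ y ℤ.+ + h′))
    (cong₂ ℤ._*_ (cong₂ ℤ._-_ (sym (ℤ.pos-+ y h′)) (sym (pos-+₃ y h′ h))) (cong₂ ℤ._-_ (sym (pos-+₃ x w w′)) (sym (ℤ.pos-+ x w))))))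
  (trans (cong ℤ.-_ (ℤ.pos-* h′ w)) (trans (right (+ h′) (+ w) (+ x) (+ y))
    (cong₂ ℤ._*_ (cong (λ z → + y ℤ.- z) (sym (ℤ.pos-+ y h′))) (cong (ℤ._- + x) (sym (ℤ.pos-+ x w))))))
  (ℤ.neg-mono-< (ℤ.+<+ h′w<hw′))
  where
  pos-+₃ : ∀ a b c → + (a + b + c) ≡ + a ℤ.+ + b ℤ.+ + c
  pos-+₃ a b c = trans (ℤ.pos-+ (a + b) c) (cong (ℤ._+ + c) (ℤ.pos-+ a b))
  left : ∀ h w x y → ℤ.- (h ℤ.* w) ≡ (y ℤ.- (y ℤ.+ h)) ℤ.* ((x ℤ.+ w) ℤ.- x)
  left = ℤ-Solver.solve-∀
  right : ∀ h w x y → ℤ.- (h ℤ.* w) ≡ (y ℤ.- (y ℤ.+ h)) ℤ.* ((x ℤ.+ w) ℤ.- x)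
  right = ℤ-Solver.solve-∀

pairs-applyUpTo : ∀ {P : Pt × Pt → Set} f n → (∀ i → suc i < n → P (f i , f (suc i))) →
  All P (pairs (applyUpTo f n))
pairs-applyUpTo f zero          h = []
pairs-applyUpTo f (suc zero)    h = []
pairs-applyUpTo f (suc (suc n)) h =
  h 0 (s≤s (s≤s z≤n)) ∷ pairs-applyUpTo (f ∘ suc) (suc n) (λ i i< → h (suc i) (s≤s i<))

triples-applyUpTo : ∀ {P : Pt × Pt × Pt → Set} f n →
  (∀ i → suc (suc i) < n → P (f i , f (suc i) , f (suc (suc i)))) → All P (triples (applyUpTo f n))
triples-applyUpTo f zero                h = []
triples-applyUpTo f (suc zero)          h = []
triples-applyUpTo f (suc (suc zero))    h = []
triples-applyUpTo f (suc (suc (suc n))) h =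
  h 0 (s≤s (s≤s (s≤s z≤n))) ∷ triples-applyUpTo (f ∘ suc) (suc (suc n)) (λ i i< → h (suc i) (s≤s i<))

lastPt-applyUpTo : ∀ (f : ℕ → Pt) n → lastPt (f 0) (applyUpTo (f ∘ suc) n) ≡ f n
lastPt-applyUpTo f zero    = refl
lastPt-applyUpTo f (suc n) = lastPt-applyUpTo (f ∘ suc) n

VanishesBelow : ℕ → Poly → Set
VanishesBelow a f = ∀ i → i < a → coeff f i ≡ 0ℤ

⊗-vanishesBelow : ∀ {a} f {g} → VanishesBelow a g → VanishesBelow a (f ⊗ g)
⊗-vanishesBelow []      h i i<a = refl
⊗-vanishesBelow (c ∷ f) {g} h i i<a = trans (coeff-⊕ (scale c g) (0ℤ ∷ (f ⊗ g)) i)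
  (cong₂ ℤ._+_ (trans (coeff-scale c g i) (trans (cong (c ℤ.*_) (h i i<a)) (ℤ.*-zeroʳ c))) (shifted i i<a))
  where
  shifted : ∀ i → i < _ → coeff (0ℤ ∷ (f ⊗ g)) i ≡ 0ℤ
  shifted zero    _   = refl
  shifted (suc i) i<a = ⊗-vanishesBelow f h i (ℕ.<-trans (ℕ.n<1+n i) i<a)

X⊗-vanishesBelow : ∀ {a f} → VanishesBelow a f → VanishesBelow (suc a) (X ⊗ f)
X⊗-vanishesBelow {f = f} h i i<a = trans (coeffs X⊗f≋ i) (shifted i i<a)
  where
  X⊗f≋ : X ⊗ f ≋ 0ℤ ∷ f
  X⊗f≋ = ≋-trans (0∷-⊗ (1ℤ ∷ []) f) (∷-cong refl (⊗-identityˡ f))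
  shifted : ∀ i → i < suc _ → coeff (0ℤ ∷ f) i ≡ 0ℤ
  shifted zero    _         = refl
  shifted (suc i) (s≤s i<a) = h i i<a

-- The polygon of 𝒢 and the concatenation that gives the polygon of τ.

module Polygons (k : ℕ) (prime : Prime (suc (suc k))) (1≤k : 1 ≤ k) where

  open Dynamics k using (d)
  open Valuation prime
  open Estimates k prime

  -- The two bounds may come with different exponents for the same coefficient; the larger exponent
  -- satisfies both.
  strongest : ∀ {x a b} i → Σ[ u ∈ ℕ ] (+ (d ^ u) ∣ x × a ≤ suc k * u + 1 * i) →
    Σ[ v ∈ ℕ ] (+ (d ^ v) ∣ x × b ≤ 1 * v + 0 * i) →
    Σ[ v ∈ ℕ ] (+ (d ^ v) ∣ x × a ≤ suc k * v + 1 * i × b ≤ v)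
  strongest {b = b} i (u , dᵘ∣ , a≤) (v , dᵛ∣ , b≤) with ℕ.≤-total u v
  ... | inj₁ u≤v = v , dᵛ∣
      , ℕ.≤-trans a≤ (ℕ.+-monoˡ-≤ (1 * i) (ℕ.*-monoʳ-≤ (suc k) u≤v))
      , subst (b ≤_) (trans (ℕ.+-identityʳ _) (ℕ.*-identityˡ v)) b≤
  ... | inj₂ v≤u = u , dᵘ∣ , a≤
      , ℕ.≤-trans (subst (b ≤_) (trans (ℕ.+-identityʳ _) (ℕ.*-identityˡ v)) b≤) v≤u

  D-suc : ∀ j → D d (suc j) ≡ d ^ j + D d j
  D-suc zero    = cong suc (ℕ.*-zeroʳ d)
  D-suc (suc j) = trans (cong (λ z → 1 + d * z) (D-suc j)) (identity d (d ^ j) (D d j))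
    where
    identity : ∀ d a b → 1 + d * (a + b) ≡ d * a + (1 + d * b)
    identity = ℕ-Solver.solve-∀

  e-mono : ∀ {i n} → i ≤ n → suc (e i) ≤ suc (e n)
  e-mono {i} {n} i≤n = subst₂ _≤_ (d^≡ i) (d^≡ n) (ℕ.^-monoʳ-≤ d i≤n)

  3e≤e : ∀ {n i} → n < i → 3 * suc (e n) ≤ suc (e i)
  3e≤e {n} {i} n<i = begin
    3 * suc (e n)     ≤⟨ ℕ.*-monoˡ-≤ (suc (e n)) (s≤s (s≤s 1≤k)) ⟩
    d * suc (e n)     ≡⟨ cong (d *_) (d^≡ n) ⟨
    d ^ suc n         ≡⟨ d^≡ (suc n) ⟩
    suc (e (suc n))   ≤⟨ e-mono n<i ⟩
    suc (e i)         ∎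
    where open ℕ.≤-Reasoning

  width-positive : ∀ n → 0 < width n
  width-positive n = ℕ.≤-trans (ℕ.≤-trans 1≤k (ℕ.m≤m*n k (suc (e n)))) (ℕ.m≤n+m _ (e n))

  width+1≡ : ∀ i → width i + 1 ≡ suc k * suc (e i)
  width+1≡ i = identity k (e i)
    where
    identity : ∀ k e → e + k * (1 + e) + 1 ≡ (1 + k) * (1 + e)
    identity = ℕ-Solver.solve-∀

  vertex : ℕ → ℕ → Pt
  vertex n i = d ^ i + (n ∸ i) , d ^ i * D d (suc n ∸ i)

  vertex-+ : ∀ j i → vertex (j + i) i ≡ (j + d ^ i , d ^ i * D d (suc j))
  vertex-+ j i = cong₂ _,_ (trans (cong (λ z → d ^ i + z) (ℕ.m+n∸n≡m j i)) (ℕ.+-comm (d ^ i) j))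
    (cong (λ z → d ^ i * D d z) (ℕ.m+n∸n≡m (suc j) i))

  D-step : ∀ i j → d ^ i * D d (suc j) ≡ d ^ suc i * D d j + suc (e i)
  D-step i j = trans (identity (d ^ i) d (D d j)) (cong (λ z → d ^ suc i * D d j + z) (d^≡ i))
    where
    identity : ∀ a d D → a * (1 + d * D) ≡ d * a * D + a
    identity = ℕ-Solver.solve-∀

  x-step : ∀ i j → j + d ^ suc i ≡ suc j + d ^ i + width i
  x-step i j = trans (cong (λ z → j + z) (d^≡ (suc i))) (trans (identity j (width i) (e i))
    (cong (λ z → suc j + z + width i) (sym (d^≡ i))))
    where
    identity : ∀ j w e → j + (1 + (w + (1 + e))) ≡ 1 + j + (1 + e) + w
    identity = ℕ-Solver.solve-∀

  -- Edge i has height d^i and width (d-1)d^i - 1, so the two products differ by d^(i+1) - d^i.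
  slopes-increase : ∀ i → suc (e (suc i)) * width i < suc (e i) * width (suc i)
  slopes-increase i = ℕ.+-cancelʳ-< (suc (e (suc i))) _ _ (begin-strict
    suc (e (suc i)) * width i + suc (e (suc i))      ≡⟨ identity k (e i) ⟩
    suc (e i) * width (suc i) + suc (e i)            <⟨ ℕ.+-monoʳ-< (suc (e i) * width (suc i)) (s≤s (ℕ.<-≤-trans (ℕ.n<1+n (e i)) (ℕ.m≤n+m (suc (e i)) (width i)))) ⟩
    suc (e i) * width (suc i) + suc (e (suc i))      ∎)
    where
    open ℕ.≤-Reasoning
    identity : ∀ k e → (1 + (e + k * (1 + e) + (1 + e))) * (e + k * (1 + e)) + (1 + (e + k * (1 + e) + (1 + e))) ≡
      (1 + e) * (e + k * (1 + e) + (1 + e) + k * (1 + (e + k * (1 + e) + (1 + e)))) + (1 + e)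
    identity = ℕ-Solver.solve-∀

  module _ (G τ : ℕ → Poly)
    (G₀-hasVal      : ∀ n → HasVal d (coeff (G n) 0) (e (suc n)))
    (G-width-hasVal : ∀ n → HasVal d (coeff (G n) (width n)) (width n))
    (G-bounds       : ∀ n i → i ≢ width n → Σ[ v ∈ ℕ ] (+ (d ^ v) ∣ coeff (G n) i ×
                        suc k * width n + 1 * width n + 1 ≤ suc k * v + 1 * i × width n ≤ v))
    (G-content      : ∀ n i v → HasVal d (coeff (G n) i) v → width n ≤ v)
    (τ-content      : ∀ n i v → HasVal d (coeff (τ n) i) v → suc (e n) ≤ v)
    (τ-zero         : τ 0 ≋ bd d ⊗ negᴾ oneᴾ)
    (τ-step         : ∀ n → τ (suc n) ≋ bd d ⊗ G n ⊗ τ n)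
    where

    -- Weights (wd , N) with wd / N = d - 1 - K / N pick out one vertex of the polygon of G n:
    -- the right one if K d^n < N and the left one if K d^n > N. With ε = 0 ties are allowed.
    module Slope (wd N K ε : ℕ) {{_ : NonZero wd}} (wd+K≡ : wd + K ≡ suc k * N) where

      open Weighted wd N public

      -- Hence the left vertex of `G n` outweighs the right one by wd d^n - N width = N - K d^n,
      -- whose sign decides which of them is lighter.
      balance : ∀ n → wd * suc (e n) + K * suc (e n) ≡ N * width n + N
      balance n = begin
        wd * suc (e n) + K * suc (e n)  ≡⟨ ℕ.*-distribʳ-+ (suc (e n)) wd K ⟨
        (wd + K) * suc (e n)            ≡⟨ cong (_* suc (e n)) wd+K≡ ⟩
        suc k * N * suc (e n)           ≡⟨ identity k N (e n) ⟩
        N * width n + N                 ∎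
        where
        open ≡-Reasoning
        identity : ∀ k N e → (1 + k) * N * (1 + e) ≡ N * (e + k * (1 + e)) + N
        identity = ℕ-Solver.solve-∀

      G-start : ∀ n → ε ≤ K → ε ≤ N → N + ε ≤ K * suc (e n) → Leading ε 0 (e (suc n)) (G n)
      G-start n ε≤K ε≤N N+ε≤KM = HasVal⇒Leading (G₀-hasVal n) others
        where
        open ℕ.≤-Reasoning
        w = width n
        M = suc (e n)
        others : ∀ i → i ≢ 0 → Σ[ v ∈ ℕ ] (+ (d ^ v) ∣ coeff (G n) i × wd * (w + M) + N * 0 + ε ≤ wd * v + N * i)
        others i i≢0 with i ℕ.≟ w
        ... | yes refl = w , ∣ᵤ⇒∣ (proj₁ (proj₂ (G-width-hasVal n))) , ℕ.+-cancelʳ-≤ N _ _ (begin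
          wd * (w + M) + N * 0 + ε + N     ≡⟨ identity wd w M N ε ⟩
          wd * w + wd * M + (N + ε)        ≤⟨ ℕ.+-monoʳ-≤ (wd * w + wd * M) N+ε≤KM ⟩
          wd * w + wd * M + K * M          ≡⟨ ℕ.+-assoc (wd * w) (wd * M) (K * M) ⟩
          wd * w + (wd * M + K * M)        ≡⟨ cong (λ z → wd * w + z) (balance n) ⟩
          wd * w + (N * w + N)             ≡⟨ ℕ.+-assoc (wd * w) (N * w) N ⟨
          wd * w + N * w + N               ∎)
          where
          identity : ∀ wd w M N ε → wd * (w + M) + N * 0 + ε + N ≡ wd * w + wd * M + (N + ε)
          identity = ℕ-Solver.solve-∀
        ... | no i≢w with G-bounds n i i≢w
        ... | v , dᵛ∣ , weight≤ , _ = v , dᵛ∣ , goal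
          where
          identity : ∀ k e → (1 + k) * (e + k * (1 + e)) + 1 * (e + k * (1 + e)) + 1 ≡
            (1 + k) * (e + k * (1 + e) + (1 + e))
          identity = ℕ-Solver.solve-∀
          -- The gap of 1 in the base weights raises d w exactly to (d-1)(w + M), the base weight of
          -- the left vertex.
          steep : suc k * (w + M) ≤ suc k * v + 1 * i
          steep = subst (_≤ suc k * v + 1 * i) (identity k (e n)) weight≤
          goal : wd * (w + M) + N * 0 + ε ≤ wd * v + N * i
          goal with w + M ℕ.≤? v
          ... | yes w+M≤v = begin
            wd * (w + M) + N * 0 + ε     ≡⟨ cong (λ z → wd * (w + M) + z + ε) (ℕ.*-zeroʳ N) ⟩
            wd * (w + M) + 0 + ε         ≡⟨ cong (_+ ε) (ℕ.+-identityʳ (wd * (w + M))) ⟩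
            wd * (w + M) + ε             ≤⟨ ℕ.+-mono-≤ (ℕ.*-monoʳ-≤ wd w+M≤v) (ℕ.≤-trans ε≤N (ℕ.m≤m*n N i {{ℕ.≢-nonZero i≢0}})) ⟩
            wd * v + N * i               ∎
          -- The valuation falls short by o + 1, so the base weights force i ≥ (d-1)(o+1). The
          -- resulting N(d-1)(o+1) = (wd+K)(o+1) repays the loss wd(o+1) with at least K ≥ ε to
          -- spare.
          ... | no w+M≰v with ℕ.m≤n⇒∃[o]m+o≡n (ℕ.≰⇒> w+M≰v)
          ... | o , v+1+o≡ = begin
            wd * (w + M) + N * 0 + ε                     ≡⟨ cong (λ z → wd * z + N * 0 + ε) v+1+o≡ ⟨
            wd * (suc v + o) + N * 0 + ε                 ≡⟨ identity₁ wd v o N ε ⟩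
            wd * v + (wd * suc o + ε)                    ≤⟨ ℕ.+-monoʳ-≤ (wd * v) (ℕ.+-monoʳ-≤ (wd * suc o) (ℕ.≤-trans ε≤K (ℕ.m≤m*n K (suc o)))) ⟩
            wd * v + (wd * suc o + K * suc o)            ≡⟨ cong (λ z → wd * v + z) (ℕ.*-distribʳ-+ (suc o) wd K) ⟨
            wd * v + (wd + K) * suc o                    ≡⟨ cong (λ z → wd * v + z * suc o) wd+K≡ ⟩
            wd * v + suc k * N * suc o                   ≡⟨ identity₂ wd v k N o ⟩
            wd * v + N * (suc k * suc o)                 ≤⟨ ℕ.+-monoʳ-≤ (wd * v) (ℕ.*-monoʳ-≤ N drop) ⟩
            wd * v + N * i                               ∎
            where
            identity₁ : ∀ wd v o N ε → wd * (1 + v + o) + N * 0 + ε ≡ wd * v + (wd * (1 + o) + ε)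
            identity₁ = ℕ-Solver.solve-∀
            identity₂ : ∀ wd v k N o → wd * v + (1 + k) * N * (1 + o) ≡ wd * v + N * ((1 + k) * (1 + o))
            identity₂ = ℕ-Solver.solve-∀
            identity₃ : ∀ k v o → (1 + k) * (1 + v + o) ≡ (1 + k) * v + (1 + k) * (1 + o)
            identity₃ = ℕ-Solver.solve-∀
            drop : suc k * suc o ≤ i
            drop = ℕ.+-cancelˡ-≤ (suc k * v) _ _ (begin
              suc k * v + suc k * suc o    ≡⟨ identity₃ k v o ⟨
              suc k * (suc v + o)          ≡⟨ cong (suc k *_) v+1+o≡ ⟩
              suc k * (w + M)              ≤⟨ steep ⟩
              suc k * v + 1 * i            ≡⟨ cong (λ z → suc k * v + z) (ℕ.*-identityˡ i) ⟩
              suc k * v + i                ∎)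

      G-end : ∀ n → K * suc (e n) + ε ≤ N → Leading ε (width n) (width n) (G n)
      G-end n KM+ε≤N = HasVal⇒Leading (G-width-hasVal n) others
        where
        open ℕ.≤-Reasoning
        w = width n
        M = suc (e n)
        others : ∀ i → i ≢ w → Σ[ v ∈ ℕ ] (+ (d ^ v) ∣ coeff (G n) i × wd * w + N * w + ε ≤ wd * v + N * i)
        others i i≢w with G-bounds n i i≢w
        ... | v , dᵛ∣ , weight≤ , w≤v with ℕ.m≤n⇒∃[o]m+o≡n w≤v
        ... | t , refl = w + t , dᵛ∣ , goal
          where
          goal : wd * w + N * w + ε ≤ wd * (w + t) + N * i
          -- Up to the height w + M of the left vertex the base weights decide; from there on the
          -- valuation alone outweighs the right vertex.
          goal with ℕ.≤-total t M
          ... | inj₁ t≤M = ℕ.+-cancelʳ-≤ (K * w + K * t) _ _ (begin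
            wd * w + N * w + ε + (K * w + K * t)         ≡⟨ identity₁ wd w N ε K t ⟩
            wd * w + K * w + N * w + (K * t + ε)         ≤⟨ ℕ.+-monoʳ-≤ (wd * w + K * w + N * w) (ℕ.≤-trans (ℕ.+-monoˡ-≤ ε (ℕ.*-monoʳ-≤ K t≤M)) KM+ε≤N) ⟩
            wd * w + K * w + N * w + N                   ≡⟨ cong (λ z → z + N * w + N) (ℕ.*-distribʳ-+ w wd K) ⟨
            (wd + K) * w + N * w + N                     ≡⟨ cong (λ z → z * w + N * w + N) wd+K≡ ⟩
            suc k * N * w + N * w + N                    ≡⟨ identity₂ k N w ⟩
            N * (suc k * w + 1 * w + 1)                  ≤⟨ ℕ.*-monoʳ-≤ N weight≤ ⟩
            N * (suc k * (w + t) + 1 * i)                ≡⟨ identity₃ k N (w + t) i ⟩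
            suc k * N * (w + t) + N * i                  ≡⟨ cong (λ z → z * (w + t) + N * i) wd+K≡ ⟨
            (wd + K) * (w + t) + N * i                   ≡⟨ identity₄ wd K w t (N * i) ⟩
            wd * (w + t) + N * i + (K * w + K * t)       ∎)
            where
            identity₁ : ∀ wd w N ε K t → wd * w + N * w + ε + (K * w + K * t) ≡ wd * w + K * w + N * w + (K * t + ε)
            identity₁ = ℕ-Solver.solve-∀
            identity₂ : ∀ k N w → (1 + k) * N * w + N * w + N ≡ N * ((1 + k) * w + 1 * w + 1)
            identity₂ = ℕ-Solver.solve-∀
            identity₃ : ∀ k N u i → N * ((1 + k) * u + 1 * i) ≡ (1 + k) * N * u + N * i
            identity₃ = ℕ-Solver.solve-∀
            identity₄ : ∀ wd K w t z → (wd + K) * (w + t) + z ≡ wd * (w + t) + z + (K * w + K * t)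
            identity₄ = ℕ-Solver.solve-∀
          ... | inj₂ M≤t = begin
            wd * w + N * w + ε         ≡⟨ ℕ.+-assoc (wd * w) (N * w) ε ⟩
            wd * w + (N * w + ε)       ≤⟨ ℕ.+-monoʳ-≤ (wd * w) deep ⟩
            wd * w + wd * M            ≡⟨ ℕ.*-distribˡ-+ wd w M ⟨
            wd * (w + M)               ≤⟨ ℕ.*-monoʳ-≤ wd (ℕ.+-monoʳ-≤ w M≤t) ⟩
            wd * (w + t)               ≤⟨ ℕ.m≤m+n _ (N * i) ⟩
            wd * (w + t) + N * i       ∎
            where
            identity : ∀ a b c → a + b + c ≡ a + (c + b)
            identity = ℕ-Solver.solve-∀
            deep : N * w + ε ≤ wd * M
            deep = ℕ.+-cancelʳ-≤ (K * M) _ _ (begin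
              N * w + ε + K * M        ≡⟨ identity (N * w) ε (K * M) ⟩
              N * w + (K * M + ε)      ≤⟨ ℕ.+-monoʳ-≤ (N * w) KM+ε≤N ⟩
              N * w + N                ≡⟨ balance n ⟨
              wd * M + K * M           ∎)

      τ-end : ∀ n → (∀ j → j < n → K * suc (e j) + ε ≤ N) → Leading ε (suc (e n)) (suc (e n)) (τ n)
      τ-end zero    h = Leading-≋ (≋-sym τ-zero) (Leading-⊗ Leading-bd (Leading-neg Leading-one))
      τ-end (suc n) h = Leading-≋ (≋-sym (τ-step n))
        (Leading-⊗ (Leading-⊗ Leading-bd (G-end n (h n ℕ.≤-refl))) (τ-end n (λ j j<n → h j (ℕ.m<n⇒m<1+n j<n))))

      -- In the product for τ the factors `G n` with n < i contribute their right vertices and those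
      -- with n ≥ i their left ones; with the powers of bd these add up to vertex i.
      τ-leading : ∀ i j → ε ≤ K → ε ≤ N → (∀ n → n < i → K * suc (e n) + ε ≤ N) →
        (∀ n → i ≤ n → N + ε ≤ K * suc (e n)) → Leading ε (j + d ^ i) (d ^ i * D d (suc j)) (τ (j + i))
      τ-leading i zero ε≤K ε≤N below above = subst₂ (λ x y → Leading ε x y (τ i))
        (sym (d^≡ i))
        (trans (sym (d^≡ i)) (sym (trans (cong (λ z → d ^ i * suc z) (ℕ.*-zeroʳ d)) (ℕ.*-identityʳ (d ^ i)))))
        (τ-end i below)
      τ-leading i (suc j) ε≤K ε≤N below above = Leading-≋ (≋-sym (τ-step (j + i)))
        (subst (λ y → Leading ε (suc j + d ^ i) y (bd d ⊗ G (j + i) ⊗ τ (j + i))) height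
          (Leading-⊗ (Leading-⊗ Leading-bd (G-start (j + i) ε≤K ε≤N (above (j + i) (ℕ.m≤n+m i j))))
            (τ-leading i j ε≤K ε≤N below above)))
        where
        open ≡-Reasoning
        height : suc (e (suc (j + i))) + d ^ i * D d (suc j) ≡ d ^ i * D d (suc (suc j))
        height = begin
          suc (e (suc (j + i))) + d ^ i * D d (suc j)   ≡⟨ cong (_+ d ^ i * D d (suc j)) (d^≡ (suc (j + i))) ⟨
          d ^ (suc j + i) + d ^ i * D d (suc j)         ≡⟨ cong (_+ d ^ i * D d (suc j)) (trans (ℕ.^-distribˡ-+-* d (suc j) i) (ℕ.*-comm (d ^ suc j) (d ^ i))) ⟩
          d ^ i * d ^ suc j + d ^ i * D d (suc j)       ≡⟨ ℕ.*-distribˡ-+ (d ^ i) (d ^ suc j) (D d (suc j)) ⟨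
          d ^ i * (d ^ suc j + D d (suc j))             ≡⟨ cong (d ^ i *_) (D-suc (suc j)) ⟨
          d ^ i * D d (suc (suc j))                     ∎

    -- The weights (width, d^i) are normal to the edge of `G i`. Both of its ends tie there, hence K
    -- = 1 and ε = 0.
    module Edge (i : ℕ) where

      private instance
        width-nonZero : NonZero (width i)
        width-nonZero = ℕ.>-nonZero (width-positive i)

      open Slope (width i) (suc (e i)) 1 0 (width+1≡ i)

      G-filt : Filt (weight 0 (e (suc i))) (G i)
      G-filt = Leading⇒Filt (G-start i z≤n z≤n (ℕ.≤-reflexive (trans (ℕ.+-identityʳ _) (sym (ℕ.*-identityˡ _)))))

      G-above : ∀ j v → HasVal d (coeff (G i) j) v → width i * e (suc i) + suc (e i) * 0 ≤ width i * v + suc (e i) * j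
      G-above j v = Filt⇒≤weight {i = j} {v} G-filt

      τ-above : ∀ j l v → HasVal d (coeff (τ (j + i)) l) v →
        width i * (d ^ i * D d (suc j)) + suc (e i) * (j + d ^ i) ≤ width i * v + suc (e i) * l
      τ-above j l v = Filt⇒≤weight {i = l} {v} (Leading⇒Filt (τ-leading i j z≤n z≤n
        (λ n n<i → ℕ.≤-trans (ℕ.≤-reflexive (trans (ℕ.+-identityʳ _) (ℕ.*-identityˡ _))) (e-mono (ℕ.<⇒≤ n<i)))
        (λ n i≤n → ℕ.≤-trans (ℕ.≤-reflexive (ℕ.+-identityʳ _)) (ℕ.≤-trans (e-mono i≤n) (ℕ.≤-reflexive (sym (ℕ.*-identityˡ _)))))))

    -- A slope strictly between those of edges i - 1 and i needs d^(i-1) < N/K < d^i. The ratio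
    -- 2d^i/3 serves, because 3 d^n ≤ d^i for n < i, by d ≥ 3.
    module Vertex (i : ℕ) where

      private
        N = 2 * suc (e i)

        4≤ : 4 ≤ suc k * N
        4≤ = ℕ.*-mono-≤ (s≤s 1≤k) (ℕ.*-monoʳ-≤ 2 (s≤s z≤n))

        instance
          wd-nonZero : NonZero (suc k * N ∸ 3)
          wd-nonZero = ℕ.>-nonZero (ℕ.m<n⇒0<n∸m 4≤)

      open Slope (suc k * N ∸ 3) N 3 1 (ℕ.m∸n+n≡m (ℕ.<⇒≤ 4≤))

      τ-hasVal : ∀ j → HasVal d (coeff (τ (j + i)) (j + d ^ i)) (d ^ i * D d (suc j))
      τ-hasVal j = Leading⇒HasVal (τ-leading i j (s≤s z≤n) (s≤s z≤n) below above)
        where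
        open ℕ.≤-Reasoning
        below : ∀ n → n < i → 3 * suc (e n) + 1 ≤ N
        below n n<i = begin
          3 * suc (e n) + 1          ≤⟨ ℕ.+-mono-≤ (3e≤e n<i) (s≤s z≤n) ⟩
          suc (e i) + suc (e i)      ≡⟨ cong (λ z → suc (e i) + z) (ℕ.+-identityʳ (suc (e i))) ⟨
          N                          ∎
        above : ∀ n → i ≤ n → N + 1 ≤ 3 * suc (e n)
        above n i≤n = begin
          2 * suc (e i) + 1                ≤⟨ ℕ.+-mono-≤ (ℕ.*-monoʳ-≤ 2 (e-mono i≤n)) (s≤s z≤n) ⟩
          2 * suc (e n) + suc (e n)        ≡⟨ ℕ.+-comm (2 * suc (e n)) (suc (e n)) ⟩
          3 * suc (e n)                    ∎

    G-principalNP : ∀ n → PrincipalNP d (G n) ((0 , e (suc n)) ∷ (width n , width n) ∷ [])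
    G-principalNP n =
        G₀-hasVal n ∷ G-width-hasVal n ∷ []
      , (λ _ ())
      , lowerEdge d (G n) 0 (width n) (width n) (suc (e n)) (width-positive n) (s≤s z≤n) (Edge.G-above n) ∷ []
      , []
      , G-content n

    τ-vanishesBelow : ∀ n → VanishesBelow (suc n) (τ n)
    τ-vanishesBelow n i i< = trans (coeffs (τ≋X⊗ n) i) (lemma n i i<)
      where
      identity : ∀ c x f → c ⊗ x ⊗ f ≋ x ⊗ (c ⊗ f)
      identity = solve-∀ polySolverRing
      identity′ : ∀ c x g t → c ⊗ x ⊗ g ⊗ t ≋ x ⊗ (c ⊗ g ⊗ t)
      identity′ = solve-∀ polySolverRing
      X-multiple : ℕ → Poly
      X-multiple zero    = const (+ d) ⊗ negᴾ oneᴾ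
      X-multiple (suc n) = const (+ d) ⊗ G n ⊗ τ n
      τ≋X⊗ : ∀ n → τ n ≋ X ⊗ X-multiple n
      τ≋X⊗ zero    = ≋-trans τ-zero (identity (const (+ d)) X (negᴾ oneᴾ))
      τ≋X⊗ (suc n) = ≋-trans (τ-step n) (identity′ (const (+ d)) X (G n) (τ n))
      lemma : ∀ n → VanishesBelow (suc n) (X ⊗ X-multiple n)
      lemma zero    = X⊗-vanishesBelow {f = X-multiple 0} (λ _ ())
      lemma (suc n) = X⊗-vanishesBelow {f = X-multiple (suc n)} (⊗-vanishesBelow (const (+ d) ⊗ G n) (τ-vanishesBelow n))

    τ-edge : ∀ n i → suc i < suc n → LowerEdge d (τ n) (vertex n i , vertex n (suc i))
    τ-edge n i (s≤s i<n) with ℕ.m≤n⇒∃[o]m+o≡n i<n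
    ... | j , i+1+j≡n = subst (λ P → LowerEdge d (τ n) P) (cong₂ _,_ (sym left) (sym right))
      (lowerEdge d (τ n) (suc j + d ^ i) (d ^ suc i * D d (suc j)) (width i) (suc (e i)) (width-positive i) (s≤s z≤n) above)
      where
      n≡₁ : n ≡ suc j + i
      n≡₁ = trans (sym i+1+j≡n) (cong suc (ℕ.+-comm i j))
      n≡₂ : n ≡ j + suc i
      n≡₂ = trans (sym i+1+j≡n) (ℕ.+-comm (suc i) j)
      left : vertex n i ≡ (suc j + d ^ i , d ^ suc i * D d (suc j) + suc (e i))
      left = trans (cong (λ z → vertex z i) n≡₁) (trans (vertex-+ (suc j) i) (cong (λ y → suc j + d ^ i , y) (D-step i (suc j))))
      right : vertex n (suc i) ≡ (suc j + d ^ i + width i , d ^ suc i * D d (suc j))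
      right = trans (cong (λ z → vertex z (suc i)) n≡₂) (trans (vertex-+ j (suc i)) (cong (λ x → x , d ^ suc i * D d (suc j)) (x-step i j)))
      above : ∀ l v → HasVal d (coeff (τ n) l) v → width i * (d ^ suc i * D d (suc j) + suc (e i)) + suc (e i) * (suc j + d ^ i) ≤ width i * v + suc (e i) * l
      above l v val = subst (λ y → width i * y + suc (e i) * (suc j + d ^ i) ≤ width i * v + suc (e i) * l) (D-step i (suc j))
        (Edge.τ-above i (suc j) l v (subst (λ z → HasVal d (coeff (τ z) l) v) n≡₁ val))

    τ-slopes : ∀ n i → suc (suc i) < suc n → SlopeIncr (vertex n i , vertex n (suc i) , vertex n (suc (suc i)))
    τ-slopes n i (s≤s i+1<n) with ℕ.m≤n⇒∃[o]m+o≡n i+1<n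
    ... | j , i+2+j≡n = subst SlopeIncr (cong₂ _,_ (sym first) (cong₂ _,_ (sym second) (sym third)))
      (slopeIncr (suc (suc j) + d ^ i) (d ^ suc (suc i) * D d (suc j)) (width i) (width (suc i)) (suc (e i)) (suc (e (suc i))) (slopes-increase i))
      where
      at : ∀ j′ i′ → n ≡ j′ + i′ → vertex n i′ ≡ (j′ + d ^ i′ , d ^ i′ * D d (suc j′))
      at j′ i′ n≡ = trans (cong (λ z → vertex z i′) n≡) (vertex-+ j′ i′)
      n≡ : n ≡ j + suc (suc i)
      n≡ = trans (sym i+2+j≡n) (ℕ.+-comm (suc (suc i)) j)
      y₂ : d ^ suc i * D d (suc (suc j)) ≡ d ^ suc (suc i) * D d (suc j) + suc (e (suc i))
      y₂ = D-step (suc i) (suc j)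
      x₂ : suc j + d ^ suc i ≡ suc (suc j) + d ^ i + width i
      x₂ = x-step i (suc j)
      first : vertex n i ≡ (suc (suc j) + d ^ i , d ^ suc (suc i) * D d (suc j) + suc (e (suc i)) + suc (e i))
      first = trans (at (suc (suc j)) i (trans n≡ (trans (ℕ.+-suc j (suc i)) (cong suc (ℕ.+-suc j i)))))
        (cong (λ y → suc (suc j) + d ^ i , y) (trans (D-step i (suc (suc j))) (cong (_+ suc (e i)) y₂)))
      second : vertex n (suc i) ≡ (suc (suc j) + d ^ i + width i , d ^ suc (suc i) * D d (suc j) + suc (e (suc i)))
      second = trans (at (suc j) (suc i) (trans n≡ (ℕ.+-suc j (suc i)))) (cong₂ _,_ x₂ y₂)
      third : vertex n (suc (suc i)) ≡ (suc (suc j) + d ^ i + width i + width (suc i) , d ^ suc (suc i) * D d (suc j))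
      third = trans (at j (suc (suc i)) n≡) (cong (λ x → x , d ^ suc (suc i) * D d (suc j))
        (trans (x-step (suc i) j) (cong (_+ width (suc i)) x₂)))

    τ-vertex : ∀ n {i} → i < suc n → HasVal d (coeff (τ n) (proj₁ (vertex n i))) (proj₂ (vertex n i))
    τ-vertex n {i} (s≤s i≤n) with ℕ.m≤n⇒∃[o]m+o≡n i≤n
    ... | j , i+j≡n = subst (λ P → HasVal d (coeff (τ n) (proj₁ P)) (proj₂ P))
        (sym (trans (cong (λ z → vertex z i) n≡) (vertex-+ j i)))
        (subst (λ z → HasVal d (coeff (τ z) (j + d ^ i)) (d ^ i * D d (suc j))) (sym n≡) (Vertex.τ-hasVal i j))
      where
      n≡ : n ≡ j + i
      n≡ = trans (sym i+j≡n) (ℕ.+-comm i j)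

    τ-principalNP : ∀ n → PrincipalNP d (τ n) (applyUpTo (vertex n) (suc n))
    τ-principalNP n =
        applyUpTo⁺₁ (vertex n) (suc n) (τ-vertex n)
      , τ-vanishesBelow n
      , pairs-applyUpTo (vertex n) (suc n) (τ-edge n)
      , triples-applyUpTo (vertex n) (suc n) (τ-slopes n)
      , λ i v val → subst (_≤ v) (sym last-height) (τ-content n i v val)
      where
      open ≡-Reasoning
      last-height : proj₂ (lastPt (vertex n 0) (applyUpTo (vertex n ∘ suc) n)) ≡ suc (e n)
      last-height = begin
        proj₂ (lastPt (vertex n 0) (applyUpTo (vertex n ∘ suc) n))  ≡⟨ cong proj₂ (lastPt-applyUpTo (vertex n) n) ⟩
        proj₂ (vertex n n)                                          ≡⟨ cong proj₂ (vertex-+ 0 n) ⟩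
        d ^ n * (1 + d * 0)                                         ≡⟨ cong (λ z → d ^ n * suc z) (ℕ.*-zeroʳ d) ⟩
        d ^ n * 1                                                   ≡⟨ ℕ.*-identityʳ (d ^ n) ⟩
        d ^ n                                                       ≡⟨ d^≡ n ⟩
        suc (e n)                                                   ∎

-- Application to the dynamical sequences.

module Conclusion (k : ℕ) (prime : Prime (suc (suc k))) (1≤k : 1 ≤ k) where

  open Dynamics k
  open Estimates k prime
  open ConstantCoefficient k prime 1≤k
  open Polygons k prime 1≤k

  G-bounds : ∀ n i → i ≢ width n → Σ[ v ∈ ℕ ] (+ (d ^ v) ∣ coeff (G n) i ×
    suc k * width n + 1 * width n + 1 ≤ suc k * v + 1 * i × width n ≤ v)
  G-bounds n i i≢ = strongest {coeff (G n) i} i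
    (Base.Leading-bound (Base.G-leading n) i i≢) (Content.bound (Content.G-filt n) i)

  G-width-hasVal : ∀ n → HasVal d (coeff (G n) (width n)) (width n)
  G-width-hasVal n = Base.Leading⇒HasVal (Base.G-leading n)

  content : ∀ {a f} → Content.Filt a f → ∀ i v → HasVal d (coeff f i) v → a ≤ v
  content {a} h i v val = subst (a ≤_) (trans (ℕ.+-identityʳ _) (ℕ.*-identityˡ v))
    (Content.Filt⇒≤weight {i = i} {v} h val)

  G-polygon : ∀ n → PrincipalNP d (G n) ((0 , e (suc n)) ∷ (width n , width n) ∷ [])
  G-polygon = G-principalNP G τₙ G₀-hasVal G-width-hasVal G-bounds (λ n → content (Content.G-filt n))
    (λ n → content (Content.τ-filt n)) (τ≋bdθ 0) τ-step

  τ-polygon : ∀ n → PrincipalNP d (τₙ n) (applyUpTo (vertex n) (suc n))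
  τ-polygon = τ-principalNP G τₙ G₀-hasVal G-width-hasVal G-bounds (λ n → content (Content.G-filt n))
    (λ n → content (Content.τ-filt n)) (τ≋bdθ 0) τ-step

theorem4p4 : (d : ℕ) → Prime d → 3 ≤ d → (m : ℕ) → 1 ≤ m →
    (Σ[ G ∈ Poly ] (IsGm d m G ×
    PrincipalNP d G ((0 , d ^ m ∸ 1) ∷ (d ^ m ∸ d ^ (m ∸ 1) ∸ 1 , d ^ m ∸ d ^ (m ∸ 1) ∸ 1) ∷ [])))
    × PrincipalNP d (τ d m) (map (λ i → (d ^ i + (m ∸ 1 ∸ i) , d ^ i * D d (m ∸ i))) (upTo m))
theorem4p4 (suc (suc k)) pr (s≤s (s≤s 1≤k)) (suc n) _ =
    (G n , isGm n , subst₂ (λ y x → PrincipalNP d (G n) ((0 , y) ∷ (x , x) ∷ []))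
      (sym (cong (_∸ 1) (d^≡ (suc n)))) (sym width≡) (G-polygon n))
  , subst (PrincipalNP d (τₙ n)) (sym (map-upTo (vertex n) (suc n))) (τ-polygon n)
  where
  open Dynamics k
  open Estimates k pr
  open Polygons k pr 1≤k
  open Conclusion k pr 1≤k
  width≡ : d ^ suc n ∸ d ^ n ∸ 1 ≡ width n
  -- `suc (e (suc n))` computes to `suc (width n) + suc (e n)`, so neither truncated subtraction
  -- loses anything.
  width≡ = trans (cong₂ (λ a b → a ∸ b ∸ 1) (d^≡ (suc n)) (d^≡ n)) (cong (_∸ 1) (ℕ.m+n∸n≡m (suc (width n)) (suc (e n))))
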